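{- The hypergraph $\mathsf H_{20}$ (defined in the context) has no faithful orthogonal representation in $\mathbb R^3$.
   Context: Inner product: $\langle x,y\rangle=\sum_{k}\overline{x_k}\,y_k$ (over $\mathbb R$, the standard dot product). Faithful orthogonal representation: let $\mathsf H=(V,\mathcal E)$ be a three-uniform hypergraph, $\mathbb F\in\{\mathbb R,\mathbb C\}$ and $d\ge 3$. A faithful orthogonal representation of $\mathsf H$ in $\mathbb F^d$ assigns to every $v\in V$ a nonzero vector $x_v\in\mathbb F^d$ such that (1) distinct vertices determine distinct rays (one-dimensional subspaces), and (2) for distinct $u,v\in V$, $\langle x_u,x_v\rangle=0$ if and only if $u$ and $v$ belong to a common hyperedge. The hypergraph $\mathsf H_{20}$: it has 20 vertices, namely $v_0,\ldots,v_7$ (midpoints), $v_{01},v_{12},v_{23},v_{34},v_{45},v_{56},v_{67},v_{70}$ (corners; also written $v_{j,j+1}$ with indices modulo $8$), and $a_1,a_2,b_1,b_2$. It has 12 hyperedges: $E_j=\{v_{j-1,j},\,v_j,\,v_{j,j+1}\}$ for $j=0,\ldots,7$ (indices modulo $8$), and $D_0=\{v_0,a_1,v_4\}$, $D_2=\{v_2,a_2,v_6\}$, $D_1=\{v_1,b_2,v_5\}$, $D_3=\{v_3,b_1,v_7\}$. -}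

module Defs where

open import Data.Fin.Base using (Fin; zero; suc; inject₁)
open import Data.Fin.Patterns
open import Data.Nat.Base as ℕ using (ℕ; _⊔_)
import Data.Nat.Properties as ℕ
open import Data.Product.Base using (∃-syntax; _×_; _,_; proj₁; proj₂)
open import Data.Rational.Base as ℚ using (ℚ; 0ℚ; 1ℚ; ½; ∣_∣)
import Data.Rational.Properties as ℚ
open import Data.Rational.Solver using (module +-*-Solver)
open import Data.Vec.Functional using (Vector; []; _∷_; foldr; map; zipWith)
open import Function.Bundles using (_⇔_)
open import Function.Definitions using (Injective)
open import Level using (0ℓ)
open import Relation.Binary.Core using (Rel)
open import Relation.Binary.PropositionalEquality
  using (_≡_; _≢_; refl; sym; trans; cong; subst; module ≡-Reasoning)
open import Relation.Nullary.Negation.Core using (¬_; contradiction)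
open import Relation.Unary using (Pred; _≐_)

------------------------------------------------------------------------
-- The real numbers, as Cauchy sequences of rationals modulo null
-- sequences.  There are no quotients here, so equality of reals is the
-- relation _≈_.

IsCauchy : (ℕ → ℚ) → Set
IsCauchy s = ∀ ε → 0ℚ ℚ.< ε →
  ∃[ N ] ∀ m n → N ℕ.≤ m → N ℕ.≤ n → ∣ s m ℚ.- s n ∣ ℚ.< ε

record ℝ : Set where
  constructor mkℝ
  field
    seq    : ℕ → ℚ
    cauchy : IsCauchy seq

open ℝ public

infix  4 _≈_
infixl 6 _+_
infixl 7 _*_

0ℝ : ℝ
0ℝ = mkℝ (λ _ → 0ℚ) (λ _ 0<ε → 0 , λ _ _ _ _ → 0<ε)

private

  half : ∀ ε → 0ℚ ℚ.< ε → 0ℚ ℚ.< ε ℚ.* ½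
  half ε 0<ε = ℚ.*-monoˡ-<-pos ½ 0<ε

  half+half : ∀ ε → ε ℚ.* ½ ℚ.+ ε ℚ.* ½ ≡ ε
  half+half ε = trans (sym (ℚ.*-distribˡ-+ ε ½ ½)) (ℚ.*-identityʳ ε)

  +-diff : ∀ a b c d → (a ℚ.+ b) ℚ.- (c ℚ.+ d) ≡ (a ℚ.- c) ℚ.+ (b ℚ.- d)
  +-diff = solve 4 (λ a b c d →
    (a :+ b) :- (c :+ d) := (a :- c) :+ (b :- d)) refl
    where open +-*-Solver

  *-diff : ∀ a b c d →
    (a ℚ.* b) ℚ.- (c ℚ.* d) ≡ a ℚ.* (b ℚ.- d) ℚ.+ d ℚ.* (a ℚ.- c)
  *-diff = solve 4 (λ a b c d →
    (a :* b) :- (c :* d) := a :* (b :- d) :+ d :* (a :- c)) refl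
    where open +-*-Solver

  split : ∀ a b → a ≡ b ℚ.+ (a ℚ.- b)
  split = solve 2 (λ a b → a := b :+ (a :- b)) refl
    where open +-*-Solver

  +-cauchy : ∀ s t → IsCauchy s → IsCauchy t → IsCauchy (λ n → s n ℚ.+ t n)
  +-cauchy s t cs ct ε 0<ε = M ⊔ N , close
    where
    M = proj₁ (cs (ε ℚ.* ½) (half ε 0<ε))
    N = proj₁ (ct (ε ℚ.* ½) (half ε 0<ε))

    close : ∀ m n → M ⊔ N ℕ.≤ m → M ⊔ N ℕ.≤ n →
            ∣ (s m ℚ.+ t m) ℚ.- (s n ℚ.+ t n) ∣ ℚ.< ε
    close m n m≥ n≥ = begin-strict
      ∣ (s m ℚ.+ t m) ℚ.- (s n ℚ.+ t n) ∣    ≡⟨ cong ∣_∣ (+-diff (s m) (t m) (s n) (t n)) ⟩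
      ∣ (s m ℚ.- s n) ℚ.+ (t m ℚ.- t n) ∣    ≤⟨ ℚ.∣p+q∣≤∣p∣+∣q∣ (s m ℚ.- s n) (t m ℚ.- t n) ⟩
      ∣ s m ℚ.- s n ∣ ℚ.+ ∣ t m ℚ.- t n ∣    <⟨ ℚ.+-mono-<
        (proj₂ (cs (ε ℚ.* ½) (half ε 0<ε)) m n (ℕ.m⊔n≤o⇒m≤o M N m≥) (ℕ.m⊔n≤o⇒m≤o M N n≥))
        (proj₂ (ct (ε ℚ.* ½) (half ε 0<ε)) m n (ℕ.m⊔n≤o⇒n≤o M N m≥) (ℕ.m⊔n≤o⇒n≤o M N n≥)) ⟩
      ε ℚ.* ½ ℚ.+ ε ℚ.* ½                    ≡⟨ half+half ε ⟩
      ε                                      ∎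
      where open ℚ.≤-Reasoning

  0<1 : 0ℚ ℚ.< 1ℚ
  0<1 = ℚ.positive⁻¹ 1ℚ

  eventually-bounded : ∀ s → IsCauchy s →
    ∃[ B ] 0ℚ ℚ.< B × ∃[ N ] ∀ n → N ℕ.≤ n → ∣ s n ∣ ℚ.< B
  eventually-bounded s cs =
    ∣ s N ∣ ℚ.+ 1ℚ , ℚ.+-mono-≤-< (ℚ.0≤∣p∣ (s N)) 0<1 , N , bound
    where
    N = proj₁ (cs 1ℚ 0<1)

    bound : ∀ n → N ℕ.≤ n → ∣ s n ∣ ℚ.< ∣ s N ∣ ℚ.+ 1ℚ
    bound n n≥ = begin-strict
      ∣ s n ∣                       ≡⟨ cong ∣_∣ (split (s n) (s N)) ⟩
      ∣ s N ℚ.+ (s n ℚ.- s N) ∣     ≤⟨ ℚ.∣p+q∣≤∣p∣+∣q∣ (s N) (s n ℚ.- s N) ⟩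
      ∣ s N ∣ ℚ.+ ∣ s n ℚ.- s N ∣   <⟨ ℚ.+-monoʳ-< ∣ s N ∣ (proj₂ (cs 1ℚ 0<1) n N n≥ ℕ.≤-refl) ⟩
      ∣ s N ∣ ℚ.+ 1ℚ                ∎
      where open ℚ.≤-Reasoning

  ∣p*q∣<r*s : ∀ p q r s → 0ℚ ℚ.< s → ∣ p ∣ ℚ.< r → ∣ q ∣ ℚ.< s →
              ∣ p ℚ.* q ∣ ℚ.< r ℚ.* s
  ∣p*q∣<r*s p q r s 0<s p<r q<s = begin-strict
    ∣ p ℚ.* q ∣        ≡⟨ ℚ.∣p*q∣≡∣p∣*∣q∣ p q ⟩
    ∣ p ∣ ℚ.* ∣ q ∣    ≤⟨ ℚ.*-monoˡ-≤-nonNeg ∣ p ∣ {{ℚ.nonNegative (ℚ.0≤∣p∣ p)}} (ℚ.<⇒≤ q<s) ⟩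
    ∣ p ∣ ℚ.* s        <⟨ ℚ.*-monoˡ-<-pos s {{ℚ.positive 0<s}} p<r ⟩
    r ℚ.* s            ∎
    where open ℚ.≤-Reasoning

  divide : ∀ ε C → 0ℚ ℚ.< ε → 0ℚ ℚ.< C → ∃[ δ ] 0ℚ ℚ.< δ × C ℚ.* δ ≡ ε
  divide ε C 0<ε 0<C = C⁻¹ ℚ.* ε , 0<δ , total
    where
    instance
      C-pos : ℚ.Positive C
      C-pos = ℚ.positive 0<C

      C≢0 : ℚ.NonZero C
      C≢0 = ℚ.pos⇒nonZero C

      ε-pos : ℚ.Positive ε
      ε-pos = ℚ.positive 0<ε

    C⁻¹ : ℚ
    C⁻¹ = ℚ.1/ C

    0<δ : 0ℚ ℚ.< C⁻¹ ℚ.* ε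
    0<δ = ℚ.positive⁻¹ (C⁻¹ ℚ.* ε) {{ℚ.pos*pos⇒pos C⁻¹ {{ℚ.1/pos⇒pos C}} ε}}

    total : C ℚ.* (C⁻¹ ℚ.* ε) ≡ ε
    total = begin
      C ℚ.* (C⁻¹ ℚ.* ε)    ≡⟨ ℚ.*-assoc C C⁻¹ ε ⟨
      C ℚ.* C⁻¹ ℚ.* ε      ≡⟨ cong (ℚ._* ε) (ℚ.*-inverseʳ C) ⟩
      1ℚ ℚ.* ε             ≡⟨ ℚ.*-identityˡ ε ⟩
      ε                    ∎
      where open ≡-Reasoning

  *-close : ∀ a b c d A B δ → 0ℚ ℚ.< δ → ∣ a ∣ ℚ.< A → ∣ d ∣ ℚ.< B →
            ∣ b ℚ.- d ∣ ℚ.< δ → ∣ a ℚ.- c ∣ ℚ.< δ →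
            ∣ a ℚ.* b ℚ.- c ℚ.* d ∣ ℚ.< (A ℚ.+ B) ℚ.* δ
  *-close a b c d A B δ 0<δ a<A d<B b-d<δ a-c<δ = begin-strict
    ∣ a ℚ.* b ℚ.- c ℚ.* d ∣
      ≡⟨ cong ∣_∣ (*-diff a b c d) ⟩
    ∣ a ℚ.* (b ℚ.- d) ℚ.+ d ℚ.* (a ℚ.- c) ∣
      ≤⟨ ℚ.∣p+q∣≤∣p∣+∣q∣ (a ℚ.* (b ℚ.- d)) (d ℚ.* (a ℚ.- c)) ⟩
    ∣ a ℚ.* (b ℚ.- d) ∣ ℚ.+ ∣ d ℚ.* (a ℚ.- c) ∣
      <⟨ ℚ.+-mono-< (∣p*q∣<r*s a (b ℚ.- d) A δ 0<δ a<A b-d<δ)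
                    (∣p*q∣<r*s d (a ℚ.- c) B δ 0<δ d<B a-c<δ) ⟩
    A ℚ.* δ ℚ.+ B ℚ.* δ
      ≡⟨ ℚ.*-distribʳ-+ δ A B ⟨
    (A ℚ.+ B) ℚ.* δ
      ∎
    where open ℚ.≤-Reasoning

  *-cauchy : ∀ s t → IsCauchy s → IsCauchy t → IsCauchy (λ n → s n ℚ.* t n)
  *-cauchy s t cs ct ε 0<ε =
    let A , 0<A , M₁ , s<A = eventually-bounded s cs
        B , 0<B , N₁ , t<B = eventually-bounded t ct
        δ , 0<δ , [A+B]δ≡ε = divide ε (A ℚ.+ B) 0<ε (ℚ.+-mono-< 0<A 0<B)
        M₂ , s-close = cs δ 0<δ
        N₂ , t-close = ct δ 0<δ
    in (M₁ ⊔ M₂) ⊔ (N₁ ⊔ N₂) , λ m n m≥ n≥ →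
      let mM = ℕ.m⊔n≤o⇒m≤o (M₁ ⊔ M₂) (N₁ ⊔ N₂) m≥
          mN = ℕ.m⊔n≤o⇒n≤o (M₁ ⊔ M₂) (N₁ ⊔ N₂) m≥
          nM = ℕ.m⊔n≤o⇒m≤o (M₁ ⊔ M₂) (N₁ ⊔ N₂) n≥
          nN = ℕ.m⊔n≤o⇒n≤o (M₁ ⊔ M₂) (N₁ ⊔ N₂) n≥
      in subst (∣ s m ℚ.* t m ℚ.- s n ℚ.* t n ∣ ℚ.<_) [A+B]δ≡ε
           (*-close (s m) (t m) (s n) (t n) A B δ 0<δ
             (s<A m (ℕ.m⊔n≤o⇒m≤o M₁ M₂ mM))
             (t<B n (ℕ.m⊔n≤o⇒m≤o N₁ N₂ nN))
             (t-close m n (ℕ.m⊔n≤o⇒n≤o N₁ N₂ mN) (ℕ.m⊔n≤o⇒n≤o N₁ N₂ nN))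
             (s-close m n (ℕ.m⊔n≤o⇒n≤o M₁ M₂ mM) (ℕ.m⊔n≤o⇒n≤o M₁ M₂ nM)))

-- Opaque because unfolding these exposes the Cauchy moduli and the gcd
-- computations of ℚ, on which Agda's normalisation does not finish.

opaque

  _≈_ : Rel ℝ 0ℓ
  x ≈ y = ∀ ε → 0ℚ ℚ.< ε →
    ∃[ N ] ∀ n → N ℕ.≤ n → ∣ seq x n ℚ.- seq y n ∣ ℚ.< ε

  _+_ : ℝ → ℝ → ℝ
  x + y = mkℝ (λ n → seq x n ℚ.+ seq y n) (+-cauchy (seq x) (seq y) (cauchy x) (cauchy y))

  _*_ : ℝ → ℝ → ℝ
  x * y = mkℝ (λ n → seq x n ℚ.* seq y n) (*-cauchy (seq x) (seq y) (cauchy x) (cauchy y))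

------------------------------------------------------------------------
-- Vectors in ℝᵈ

infix 4 _≈ᵥ_

_≈ᵥ_ : ∀ {d} → Rel (Vector ℝ d) 0ℓ
x ≈ᵥ y = ∀ k → x k ≈ y k

0ᵥ : ∀ {d} → Vector ℝ d
0ᵥ _ = 0ℝ

⟨_,_⟩ : ∀ {d} → Vector ℝ d → Vector ℝ d → ℝ
⟨ x , y ⟩ = foldr _+_ 0ℝ (zipWith _*_ x y)

Ray : ∀ {d} → Vector ℝ d → Pred (Vector ℝ d) 0ℓ
Ray x y = ∃[ c ] y ≈ᵥ map (c *_) x

------------------------------------------------------------------------
-- Three-uniform hypergraphs

-- A hyperedge is presented by an enumeration of its three distinct
-- vertices; the order carries no information, since hyperedges are only
-- ever inspected through _∈_, and different hyperedges are different as
-- sets of vertices.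

record Hypergraph₃ : Set₁ where
  field
    V : Set
    E : Set
    vertices : E → Vector V 3
    distinct : ∀ e → Injective _≡_ _≡_ (vertices e)

  _∈_ : V → E → Set
  v ∈ e = ∃[ i ] vertices e i ≡ v

  field
    simple : ∀ {e f} → (_∈ e) ≐ (_∈ f) → e ≡ f

record FaithfulOrthogonalRepresentation (H : Hypergraph₃) (d : ℕ) : Set where
  open Hypergraph₃ H
  field
    x             : V → Vector ℝ d
    nonzero       : ∀ v → ¬ (x v ≈ᵥ 0ᵥ)
    distinct-rays : ∀ {u v} → u ≢ v → ¬ (Ray (x u) ≐ Ray (x v))
    orthogonal    : ∀ {u v} → u ≢ v →
                    ⟨ x u , x v ⟩ ≈ 0ℝ ⇔ (∃[ e ] u ∈ e × v ∈ e)

------------------------------------------------------------------------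
-- The hypergraph H₂₀

-- mid j is vⱼ and corner j is vⱼ,ⱼ₊₁, with indices modulo 8.

data Vertex : Set where
  mid corner  : Fin 8 → Vertex
  a₁ a₂ b₁ b₂ : Vertex

data Edge : Set where
  side        : Fin 8 → Edge
  D₀ D₁ D₂ D₃ : Edge

-- j ↦ j - 1 modulo 8
prev : Fin 8 → Fin 8
prev zero    = 7F
prev (suc j) = inject₁ j

vertices₂₀ : Edge → Vector Vertex 3
vertices₂₀ (side j) = corner (prev j) ∷ mid j ∷ corner j ∷ []
vertices₂₀ D₀       = mid 0F ∷ a₁ ∷ mid 4F ∷ []
vertices₂₀ D₁       = mid 1F ∷ b₂ ∷ mid 5F ∷ []
vertices₂₀ D₂       = mid 2F ∷ a₂ ∷ mid 6F ∷ []
vertices₂₀ D₃       = mid 3F ∷ b₁ ∷ mid 7F ∷ []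

private

  prev-≢ : ∀ j → prev j ≢ j
  prev-≢ 0F ()
  prev-≢ 1F ()
  prev-≢ 2F ()
  prev-≢ 3F ()
  prev-≢ 4F ()
  prev-≢ 5F ()
  prev-≢ 6F ()
  prev-≢ 7F ()

  corner-injective : ∀ {i j} → corner i ≡ corner j → i ≡ j
  corner-injective refl = refl

  distinct₂₀ : ∀ e → Injective _≡_ _≡_ (vertices₂₀ e)
  distinct₂₀ e        {0F} {0F} _  = refl
  distinct₂₀ e        {1F} {1F} _  = refl
  distinct₂₀ e        {2F} {2F} _  = refl
  distinct₂₀ (side j) {0F} {2F} eq = contradiction (corner-injective eq) (prev-≢ j)
  distinct₂₀ (side j) {2F} {0F} eq = contradiction (sym (corner-injective eq)) (prev-≢ j)
  distinct₂₀ (side j) {0F} {1F} ()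
  distinct₂₀ (side j) {1F} {0F} ()
  distinct₂₀ (side j) {1F} {2F} ()
  distinct₂₀ (side j) {2F} {1F} ()
  distinct₂₀ D₀       {0F} {1F} ()
  distinct₂₀ D₀       {0F} {2F} ()
  distinct₂₀ D₀       {1F} {0F} ()
  distinct₂₀ D₀       {1F} {2F} ()
  distinct₂₀ D₀       {2F} {0F} ()
  distinct₂₀ D₀       {2F} {1F} ()
  distinct₂₀ D₁       {0F} {1F} ()
  distinct₂₀ D₁       {0F} {2F} ()
  distinct₂₀ D₁       {1F} {0F} ()
  distinct₂₀ D₁       {1F} {2F} ()
  distinct₂₀ D₁       {2F} {0F} ()
  distinct₂₀ D₁       {2F} {1F} ()
  distinct₂₀ D₂       {0F} {1F} ()
  distinct₂₀ D₂       {0F} {2F} ()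
  distinct₂₀ D₂       {1F} {0F} ()
  distinct₂₀ D₂       {1F} {2F} ()
  distinct₂₀ D₂       {2F} {0F} ()
  distinct₂₀ D₂       {2F} {1F} ()
  distinct₂₀ D₃       {0F} {1F} ()
  distinct₂₀ D₃       {0F} {2F} ()
  distinct₂₀ D₃       {1F} {0F} ()
  distinct₂₀ D₃       {1F} {2F} ()
  distinct₂₀ D₃       {2F} {0F} ()
  distinct₂₀ D₃       {2F} {1F} ()

  infix 4 _∈₂₀_

  _∈₂₀_ : Vertex → Edge → Set
  v ∈₂₀ e = ∃[ i ] vertices₂₀ e i ≡ v

  a₁∈⇒D₀ : ∀ f → a₁ ∈₂₀ f → D₀ ≡ f
  a₁∈⇒D₀ (side j) (0F , ())
  a₁∈⇒D₀ (side j) (1F , ())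
  a₁∈⇒D₀ (side j) (2F , ())
  a₁∈⇒D₀ D₀       _ = refl
  a₁∈⇒D₀ D₁       (0F , ())
  a₁∈⇒D₀ D₁       (1F , ())
  a₁∈⇒D₀ D₁       (2F , ())
  a₁∈⇒D₀ D₂       (0F , ())
  a₁∈⇒D₀ D₂       (1F , ())
  a₁∈⇒D₀ D₂       (2F , ())
  a₁∈⇒D₀ D₃       (0F , ())
  a₁∈⇒D₀ D₃       (1F , ())
  a₁∈⇒D₀ D₃       (2F , ())

  b₂∈⇒D₁ : ∀ f → b₂ ∈₂₀ f → D₁ ≡ f
  b₂∈⇒D₁ (side j) (0F , ())
  b₂∈⇒D₁ (side j) (1F , ())
  b₂∈⇒D₁ (side j) (2F , ())
  b₂∈⇒D₁ D₀       (0F , ())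
  b₂∈⇒D₁ D₀       (1F , ())
  b₂∈⇒D₁ D₀       (2F , ())
  b₂∈⇒D₁ D₁       _ = refl
  b₂∈⇒D₁ D₂       (0F , ())
  b₂∈⇒D₁ D₂       (1F , ())
  b₂∈⇒D₁ D₂       (2F , ())
  b₂∈⇒D₁ D₃       (0F , ())
  b₂∈⇒D₁ D₃       (1F , ())
  b₂∈⇒D₁ D₃       (2F , ())

  a₂∈⇒D₂ : ∀ f → a₂ ∈₂₀ f → D₂ ≡ f
  a₂∈⇒D₂ (side j) (0F , ())
  a₂∈⇒D₂ (side j) (1F , ())
  a₂∈⇒D₂ (side j) (2F , ())
  a₂∈⇒D₂ D₀       (0F , ())
  a₂∈⇒D₂ D₀       (1F , ())
  a₂∈⇒D₂ D₀       (2F , ())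
  a₂∈⇒D₂ D₁       (0F , ())
  a₂∈⇒D₂ D₁       (1F , ())
  a₂∈⇒D₂ D₁       (2F , ())
  a₂∈⇒D₂ D₂       _ = refl
  a₂∈⇒D₂ D₃       (0F , ())
  a₂∈⇒D₂ D₃       (1F , ())
  a₂∈⇒D₂ D₃       (2F , ())

  b₁∈⇒D₃ : ∀ f → b₁ ∈₂₀ f → D₃ ≡ f
  b₁∈⇒D₃ (side j) (0F , ())
  b₁∈⇒D₃ (side j) (1F , ())
  b₁∈⇒D₃ (side j) (2F , ())
  b₁∈⇒D₃ D₀       (0F , ())
  b₁∈⇒D₃ D₀       (1F , ())
  b₁∈⇒D₃ D₀       (2F , ())
  b₁∈⇒D₃ D₁       (0F , ())
  b₁∈⇒D₃ D₁       (1F , ())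
  b₁∈⇒D₃ D₁       (2F , ())
  b₁∈⇒D₃ D₂       (0F , ())
  b₁∈⇒D₃ D₂       (1F , ())
  b₁∈⇒D₃ D₂       (2F , ())
  b₁∈⇒D₃ D₃       _ = refl

  side-unique : ∀ j f → mid j ∈₂₀ f → corner j ∈₂₀ f → side j ≡ f
  side-unique j (side .j) (1F , refl) _ = refl
  side-unique j (side _)  (0F , ())
  side-unique j (side _)  (2F , ())
  side-unique j D₀        _ (0F , ())
  side-unique j D₀        _ (1F , ())
  side-unique j D₀        _ (2F , ())
  side-unique j D₁        _ (0F , ())
  side-unique j D₁        _ (1F , ())
  side-unique j D₁        _ (2F , ())
  side-unique j D₂        _ (0F , ())
  side-unique j D₂        _ (1F , ())
  side-unique j D₂        _ (2F , ())
  side-unique j D₃        _ (0F , ())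
  side-unique j D₃        _ (1F , ())
  side-unique j D₃        _ (2F , ())

  simple₂₀ : ∀ {e f} → (_∈₂₀ e) ≐ (_∈₂₀ f) → e ≡ f
  simple₂₀ {side j} {f} (e⊆f , _) = side-unique j f (e⊆f (1F , refl)) (e⊆f (2F , refl))
  simple₂₀ {D₀}     {f} (e⊆f , _) = a₁∈⇒D₀ f (e⊆f (1F , refl))
  simple₂₀ {D₁}     {f} (e⊆f , _) = b₂∈⇒D₁ f (e⊆f (1F , refl))
  simple₂₀ {D₂}     {f} (e⊆f , _) = a₂∈⇒D₂ f (e⊆f (1F , refl))
  simple₂₀ {D₃}     {f} (e⊆f , _) = b₁∈⇒D₃ f (e⊆f (1F , refl))

H₂₀ : Hypergraph₃
H₂₀ = record
  { V        = Vertex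
  ; E        = Edge
  ; vertices = vertices₂₀
  ; distinct = distinct₂₀
  ; simple   = simple₂₀
  }

{-# OPTIONS --safe #-}
-- Let A, B, C, D be the corners v₀₁, v₂₃, v₄₅, v₆₇ of a representation.  The
-- other corners are normal to the planes spanned by consecutive ones among
-- them, so each midpoint is, up to scale, the component of one of A, B, C, D
-- orthogonal to a neighbour.  For unit vectors with inner products a = AB,
-- b = BC, c = CD, d = AD, e = AC, f = BD, the edges D₀ and D₁ then say
--   f + bd e = bc + ad   and   f + ac e = bc + ad,
-- whence ac = bd =: t as e ≠ 0, and D₂ says e + t f = ab + cd.  Solving for e
-- and f, the Gram determinant of A, B, C, D becomes
--   XY / (1 - t²) + t² (XY)² / (1 - t²)⁴,
-- where X = (1 - a²)(1 - c²) and Y = (1 - b²)(1 - d²).  This is positive,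
-- although four vectors in ℝ³ are linearly dependent.  Everything below is
-- homogenised, so that neither normalisation nor division is needed.

module Submission where

open import Algebra.Bundles using (CommutativeRing)
open import Algebra.Structures using (IsCommutativeRing)
import Algebra.Solver.Ring
open import Algebra.Solver.Ring.AlmostCommutativeRing
  using (fromCommutativeRing; _-Raw-AlmostCommutative⟶_)
open import Data.Empty using (⊥)
open import Data.Fin.Base using (Fin)
open import Data.Fin.Patterns
open import Data.Fin.Properties using (_≟_; any?)
open import Data.Maybe.Base as Maybe using (Maybe)
open import Data.Nat.Base as ℕ using (ℕ; _⊔_)
import Data.Nat.Properties as ℕ
open import Data.Product.Base using (∃-syntax; _×_; _,_; proj₁; proj₂)
open import Data.Rational.Base as ℚ using (ℚ; 0ℚ; 1ℚ; ½; ∣_∣)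
import Data.Rational.Properties as ℚ
import Data.Rational.Solver as ℚ-Solver
open import Data.Sum.Base using (_⊎_; inj₁; inj₂)
open import Data.Vec.Functional using (Vector; []; _∷_)
open import Defs
open import Function.Base using (_∘_)
open import Function.Bundles using (Equivalence)
open import Level using (0ℓ)
import Relation.Binary.Reasoning.Setoid as SetoidReasoning
open import Relation.Binary.Structures using (IsEquivalence)
open import Relation.Binary.PropositionalEquality as ≡ using (_≡_; _≢_; cong; subst)
open import Relation.Nullary.Decidable.Core
  using (Dec; yes; no; dec⇒maybe; False; toWitnessFalse; _×-dec_; _⊎-dec_)
open import Relation.Nullary.Negation.Core using (¬_; contradiction)

-- Null sequences of rationals

IsNull : (ℕ → ℚ) → Set
IsNull s = ∀ ε → 0ℚ ℚ.< ε → ∃[ N ] ∀ n → N ℕ.≤ n → ∣ s n ∣ ℚ.< ε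

0<ε*½ : ∀ {ε} → 0ℚ ℚ.< ε → 0ℚ ℚ.< ε ℚ.* ½
0<ε*½ 0<ε = ℚ.*-monoˡ-<-pos ½ 0<ε

ε*½+ε*½≡ε : ∀ ε → ε ℚ.* ½ ℚ.+ ε ℚ.* ½ ≡ ε
ε*½+ε*½≡ε ε = ≡.trans (≡.sym (ℚ.*-distribˡ-+ ε ½ ½)) (ℚ.*-identityʳ ε)

null-resp : ∀ {s t} → (∀ n → s n ≡ t n) → IsNull s → IsNull t
null-resp s≡t null ε 0<ε with null ε 0<ε
... | N , small = N , λ n N≤n → subst (λ q → ∣ q ∣ ℚ.< ε) (s≡t n) (small n N≤n)

null-≤ : ∀ {s t} → (∀ n → ∣ s n ∣ ℚ.≤ ∣ t n ∣) → IsNull t → IsNull s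
null-≤ s≤t null ε 0<ε with null ε 0<ε
... | N , small = N , λ n N≤n → ℚ.≤-<-trans (s≤t n) (small n N≤n)

null-0 : IsNull (λ _ → 0ℚ)
null-0 ε 0<ε = 0 , λ _ _ → 0<ε

null-+ : ∀ {s t} → IsNull s → IsNull t → IsNull (λ n → s n ℚ.+ t n)
null-+ {s} {t} s-null t-null ε 0<ε
  with s-null (ε ℚ.* ½) (0<ε*½ 0<ε) | t-null (ε ℚ.* ½) (0<ε*½ 0<ε)
... | M , s-small | N , t-small = M ⊔ N , λ n M⊔N≤n → begin-strict
    ∣ s n ℚ.+ t n ∣        ≤⟨ ℚ.∣p+q∣≤∣p∣+∣q∣ (s n) (t n) ⟩
    ∣ s n ∣ ℚ.+ ∣ t n ∣    <⟨ ℚ.+-mono-< (s-small n (ℕ.m⊔n≤o⇒m≤o M N M⊔N≤n))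
                                         (t-small n (ℕ.m⊔n≤o⇒n≤o M N M⊔N≤n)) ⟩
    ε ℚ.* ½ ℚ.+ ε ℚ.* ½    ≡⟨ ε*½+ε*½≡ε ε ⟩
    ε                      ∎
  where open ℚ.≤-Reasoning

∣p∣≤∣q∣+∣p-q∣ : ∀ p q → ∣ p ∣ ℚ.≤ ∣ q ∣ ℚ.+ ∣ p ℚ.- q ∣
∣p∣≤∣q∣+∣p-q∣ p q = subst (λ r → ∣ r ∣ ℚ.≤ ∣ q ∣ ℚ.+ ∣ p ℚ.- q ∣)
  (solve 2 (λ p q → q :+ (p :- q) := p) ≡.refl p q) (ℚ.∣p+q∣≤∣p∣+∣q∣ q (p ℚ.- q))
  where open ℚ-Solver.+-*-Solver

-- `B` bounds the Cauchy factor from index `M` on, so it suffices to make the null factor smaller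
-- than ε divided by `B`.
null-cauchy-* : ∀ {s t} → IsCauchy s → IsNull t → IsNull (λ n → s n ℚ.* t n)
null-cauchy-* {s} {t} s-cauchy t-null ε 0<ε = M ⊔ N , λ n M⊔N≤n → begin-strict
    ∣ s n ℚ.* t n ∣        ≡⟨ ℚ.∣p*q∣≡∣p∣*∣q∣ (s n) (t n) ⟩
    ∣ s n ∣ ℚ.* ∣ t n ∣    ≤⟨ ℚ.*-monoʳ-≤-nonNeg ∣ t n ∣ {{ℚ.∣-∣-nonNeg (t n)}}
                              (s-bounded n (ℕ.m⊔n≤o⇒m≤o M N M⊔N≤n)) ⟩
    B ℚ.* ∣ t n ∣          <⟨ ℚ.*-monoʳ-<-pos B (t-small n (ℕ.m⊔n≤o⇒n≤o M N M⊔N≤n)) ⟩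
    B ℚ.* (ℚ.1/ B ℚ.* ε)   ≡⟨ ℚ.*-assoc B (ℚ.1/ B) ε ⟨
    B ℚ.* ℚ.1/ B ℚ.* ε     ≡⟨ cong (ℚ._* ε) (ℚ.*-inverseʳ B) ⟩
    1ℚ ℚ.* ε               ≡⟨ ℚ.*-identityˡ ε ⟩
    ε                      ∎
  where
  open ℚ.≤-Reasoning

  M = proj₁ (s-cauchy 1ℚ (ℚ.positive⁻¹ 1ℚ))

  B : ℚ
  B = ∣ s M ∣ ℚ.+ 1ℚ

  instance
    B-positive : ℚ.Positive B
    B-positive = ℚ.nonNeg+pos⇒pos ∣ s M ∣ {{ℚ.∣-∣-nonNeg (s M)}} 1ℚ

    B-nonZero : ℚ.NonZero B
    B-nonZero = ℚ.pos⇒nonZero B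

  s-bounded : ∀ n → M ℕ.≤ n → ∣ s n ∣ ℚ.≤ B
  s-bounded n M≤n = begin
    ∣ s n ∣                        ≤⟨ ∣p∣≤∣q∣+∣p-q∣ (s n) (s M) ⟩
    ∣ s M ∣ ℚ.+ ∣ s n ℚ.- s M ∣    ≤⟨ ℚ.+-monoʳ-≤ ∣ s M ∣ (ℚ.<⇒≤
      (proj₂ (s-cauchy 1ℚ (ℚ.positive⁻¹ 1ℚ)) n M M≤n ℕ.≤-refl)) ⟩
    B                              ∎

  0<ε/B : 0ℚ ℚ.< ℚ.1/ B ℚ.* ε
  0<ε/B = ℚ.positive⁻¹ (ℚ.1/ B ℚ.* ε)
    {{ℚ.pos*pos⇒pos (ℚ.1/ B) {{ℚ.1/pos⇒pos B}} ε {{ℚ.positive 0<ε}}}}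

  N = proj₁ (t-null (ℚ.1/ B ℚ.* ε) 0<ε/B)
  t-small = proj₂ (t-null (ℚ.1/ B ℚ.* ε) 0<ε/B)

-- The ring of real numbers

fromℚ : ℚ → ℝ
fromℚ q = mkℝ (λ _ → q) λ ε 0<ε → 0 , λ _ _ _ _ →
  subst (ℚ._< ε) (≡.sym (cong ∣_∣ (ℚ.+-inverseʳ q))) 0<ε

1ℝ : ℝ
1ℝ = fromℚ 1ℚ

infix 8 -_
infixl 6 _-_
infix 4 _≉_

opaque

  -_ : ℝ → ℝ
  - x = mkℝ (λ n → ℚ.- seq x n) λ ε 0<ε →
    let N , close = cauchy x ε 0<ε
    in N , λ m n N≤m N≤n → subst (ℚ._< ε)
         (≡.trans (≡.sym (ℚ.∣-p∣≡∣p∣ _)) (cong ∣_∣ (ℚ.neg-distrib-+ (seq x m) (ℚ.- seq x n))))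
         (close m n N≤m N≤n)

_-_ : ℝ → ℝ → ℝ
x - y = x + - y

_≉_ : ℝ → ℝ → Set
x ≉ y = ¬ (x ≈ y)

opaque
  unfolding _≈_ -_

  -- The ring axioms, as opposed to the congruences, hold term by term in ℚ and are lifted through
  -- this lemma.
  pointwise : ∀ x y → (∀ n → seq x n ≡ seq y n) → x ≈ y
  pointwise x y x≡y = null-resp
    (λ n → ≡.sym (≡.trans (cong (ℚ._- seq y n) (x≡y n)) (ℚ.+-inverseʳ (seq y n)))) null-0

  ≈-isEquivalence : IsEquivalence _≈_
  ≈-isEquivalence = record
    { refl  = λ {x} → null-resp (λ n → ≡.sym (ℚ.+-inverseʳ (seq x n))) null-0
    ; sym   = λ {x} {y} x≈y → null-≤
                {s = λ n → seq y n ℚ.- seq x n} {t = λ n → seq x n ℚ.- seq y n}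
                (λ n → ℚ.≤-reflexive (≡.trans
                  (cong ∣_∣ (solve 2 (λ p q → q :- p := :- (p :- q)) ≡.refl (seq x n) (seq y n)))
                  (ℚ.∣-p∣≡∣p∣ _)))
                x≈y
    ; trans = λ {x} {y} {z} x≈y y≈z → null-resp
                (λ n → solve 3 (λ p q r → (p :- q) :+ (q :- r) := p :- r) ≡.refl
                         (seq x n) (seq y n) (seq z n))
                (null-+ {s = λ n → seq x n ℚ.- seq y n} {t = λ n → seq y n ℚ.- seq z n} x≈y y≈z)
    }
    where open ℚ-Solver.+-*-Solver

  +-cong : ∀ {x y u v} → x ≈ y → u ≈ v → x + u ≈ y + v
  +-cong {x} {y} {u} {v} x≈y u≈v = null-resp
    (λ n → solve 4 (λ x y u v → (x :- y) :+ (u :- v) := (x :+ u) :- (y :+ v)) ≡.refl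
             (seq x n) (seq y n) (seq u n) (seq v n))
    (null-+ {s = λ n → seq x n ℚ.- seq y n} {t = λ n → seq u n ℚ.- seq v n} x≈y u≈v)
    where open ℚ-Solver.+-*-Solver

  *-cong : ∀ {x y u v} → x ≈ y → u ≈ v → x * u ≈ y * v
  *-cong {x} {y} {u} {v} x≈y u≈v = null-resp
    (λ n → solve 4 (λ x y u v → x :* (u :- v) :+ v :* (x :- y) := x :* u :- y :* v) ≡.refl
             (seq x n) (seq y n) (seq u n) (seq v n))
    (null-+ (null-cauchy-* {s = seq x} {t = λ n → seq u n ℚ.- seq v n} (cauchy x) u≈v)
            (null-cauchy-* {s = seq v} {t = λ n → seq x n ℚ.- seq y n} (cauchy v) x≈y))
    where open ℚ-Solver.+-*-Solver

  -‿cong : ∀ {x y} → x ≈ y → - x ≈ - y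
  -‿cong {x} {y} x≈y = null-≤
    {s = λ n → ℚ.- seq x n ℚ.- ℚ.- seq y n} {t = λ n → seq x n ℚ.- seq y n}
    (λ n → ℚ.≤-reflexive (≡.trans
      (cong ∣_∣ (≡.sym (ℚ.neg-distrib-+ (seq x n) (ℚ.- seq y n))))
      (ℚ.∣-p∣≡∣p∣ _)))
    x≈y

opaque
  unfolding _+_ -_

  +-*-isCommutativeRing : IsCommutativeRing _≈_ _+_ _*_ -_ 0ℝ 1ℝ
  +-*-isCommutativeRing = record
    { isRing = record
      { +-isAbelianGroup = record
        { isGroup = record
          { isMonoid = record
            { isSemigroup = record
              { isMagma = record
                { isEquivalence = ≈-isEquivalence
                ; ∙-cong        = λ {x} {y} {u} {v} → +-cong {x} {y} {u} {v}
                }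
              ; assoc   = λ x y z → pointwise ((x + y) + z) (x + (y + z)) λ n →
                        ℚ.+-assoc (seq x n) (seq y n) (seq z n)
              }
            ; identity = (λ x → pointwise (0ℝ + x) x λ n → ℚ.+-identityˡ (seq x n))
                       , (λ x → pointwise (x + 0ℝ) x λ n → ℚ.+-identityʳ (seq x n))
            }
          ; inverse = (λ x → pointwise (- x + x) 0ℝ λ n → ℚ.+-inverseˡ (seq x n))
                    , (λ x → pointwise (x + - x) 0ℝ λ n → ℚ.+-inverseʳ (seq x n))
          ; ⁻¹-cong = λ {x} {y} → -‿cong {x} {y}
          }
        ; comm = λ x y → pointwise (x + y) (y + x) λ n → ℚ.+-comm (seq x n) (seq y n)
        }
      ; *-cong = λ {x} {y} {u} {v} → *-cong {x} {y} {u} {v}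
      ; *-assoc = λ x y z → pointwise ((x * y) * z) (x * (y * z)) λ n →
                ℚ.*-assoc (seq x n) (seq y n) (seq z n)
      ; *-identity = (λ x → pointwise (1ℝ * x) x λ n → ℚ.*-identityˡ (seq x n))
                   , (λ x → pointwise (x * 1ℝ) x λ n → ℚ.*-identityʳ (seq x n))
      ; distrib = (λ x y z → pointwise (x * (y + z)) (x * y + x * z) λ n →
                    ℚ.*-distribˡ-+ (seq x n) (seq y n) (seq z n))
                , (λ x y z → pointwise ((y + z) * x) (y * x + z * x) λ n →
                    ℚ.*-distribʳ-+ (seq x n) (seq y n) (seq z n))
      }
    ; *-comm = λ x y → pointwise (x * y) (y * x) λ n → ℚ.*-comm (seq x n) (seq y n)
    }

+-*-commutativeRing : CommutativeRing 0ℓ 0ℓ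
+-*-commutativeRing = record { isCommutativeRing = +-*-isCommutativeRing }

open CommutativeRing +-*-commutativeRing
  using (setoid; refl; sym; trans; +-comm; zeroˡ; zeroʳ; +-identityʳ; -‿inverseʳ)

opaque
  unfolding _+_ -_

  fromℚ-+ : ∀ p q → fromℚ (p ℚ.+ q) ≈ fromℚ p + fromℚ q
  fromℚ-+ p q = pointwise (fromℚ (p ℚ.+ q)) (fromℚ p + fromℚ q) λ _ → ≡.refl

  fromℚ-* : ∀ p q → fromℚ (p ℚ.* q) ≈ fromℚ p * fromℚ q
  fromℚ-* p q = pointwise (fromℚ (p ℚ.* q)) (fromℚ p * fromℚ q) λ _ → ≡.refl

  fromℚ-neg : ∀ p → fromℚ (ℚ.- p) ≈ - fromℚ p
  fromℚ-neg p = pointwise (fromℚ (ℚ.- p)) (- fromℚ p) λ _ → ≡.refl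

-- The solver compares only coefficients. Taking them in ℚ makes that comparison decidable, which
-- `_≈_` is not constructively.
fromℚ-morphism : CommutativeRing.rawRing ℚ.+-*-commutativeRing
                 -Raw-AlmostCommutative⟶ fromCommutativeRing +-*-commutativeRing
fromℚ-morphism = record
  { ⟦_⟧    = fromℚ
  ; +-homo = fromℚ-+
  ; *-homo = fromℚ-*
  ; -‿homo = fromℚ-neg
  ; 0-homo = pointwise (fromℚ 0ℚ) 0ℝ λ _ → ≡.refl
  ; 1-homo = refl
  }

fromℚ-≈? : ∀ p q → Maybe (fromℚ p ≈ fromℚ q)
fromℚ-≈? p q = Maybe.map (λ { ≡.refl → refl }) (dec⇒maybe (p ℚ.≟ q))

open Algebra.Solver.Ring _ _ fromℚ-morphism fromℚ-≈?
  using (Polynomial; solve; _:=_; _:+_; _:*_; :-_; _:-_)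

-- Nonnegativity and products of nonzero reals.

-- A condition on the representing sequence, not invariant under _≈_.
NonNeg : ℝ → Set
NonNeg x = ∀ n → 0ℚ ℚ.≤ seq x n

opaque
  unfolding _≈_

  nonNeg-+ : ∀ x y → NonNeg x → NonNeg y → NonNeg (x + y)
  nonNeg-+ x y 0≤x 0≤y n = ℚ.+-mono-≤ (0≤x n) (0≤y n)

  nonNeg-* : ∀ x y → NonNeg x → NonNeg y → NonNeg (x * y)
  nonNeg-* x y 0≤x 0≤y n = ℚ.nonNegative⁻¹ (seq x n ℚ.* seq y n)
    {{ℚ.nonNeg*nonNeg⇒nonNeg (seq x n) {{ℚ.nonNegative (0≤x n)}} (seq y n) {{ℚ.nonNegative (0≤y n)}}}}

  -- Signs are decided index by index in ℚ; no sign of the real `x` itself is chosen.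
  nonNeg-square : ∀ x → NonNeg (x * x)
  nonNeg-square x n with ℚ.≤-total 0ℚ (seq x n)
  ... | inj₁ 0≤x = ℚ.nonNegative⁻¹ (seq x n ℚ.* seq x n)
    {{ℚ.nonNeg*nonNeg⇒nonNeg (seq x n) {{ℚ.nonNegative 0≤x}} (seq x n) {{ℚ.nonNegative 0≤x}}}}
  ... | inj₂ x≤0 = ℚ.nonNegative⁻¹ (seq x n ℚ.* seq x n)
    {{ℚ.nonPos*nonPos⇒nonPos (seq x n) {{ℚ.nonPositive x≤0}} (seq x n) {{ℚ.nonPositive x≤0}}}}

  -- A squeeze: termwise, `x` lies between 0 and `x + y`.
  nonNeg-+-≈0 : ∀ x y → NonNeg x → NonNeg y → x + y ≈ 0ℝ → x ≈ 0ℝ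
  nonNeg-+-≈0 x y 0≤x 0≤y = null-≤ {s = λ n → seq x n ℚ.- 0ℚ} λ n → begin
    ∣ seq x n ℚ.- 0ℚ ∣                  ≡⟨ cong ∣_∣ (ℚ.+-identityʳ (seq x n)) ⟩
    ∣ seq x n ∣                         ≡⟨ ℚ.0≤p⇒∣p∣≡p (0≤x n) ⟩
    seq x n                             ≡⟨ ℚ.+-identityʳ (seq x n) ⟨
    seq x n ℚ.+ 0ℚ                      ≤⟨ ℚ.+-monoʳ-≤ (seq x n) (0≤y n) ⟩
    seq x n ℚ.+ seq y n                 ≡⟨ ℚ.0≤p⇒∣p∣≡p (ℚ.+-mono-≤ (0≤x n) (0≤y n)) ⟨
    ∣ seq x n ℚ.+ seq y n ∣             ≡⟨ cong ∣_∣ (ℚ.+-identityʳ (seq x n ℚ.+ seq y n)) ⟨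
    ∣ seq x n ℚ.+ seq y n ℚ.- 0ℚ ∣      ∎
    where open ℚ.≤-Reasoning

  -- To show x ≈ 0 one may assume, at each precision, that x is bounded
  -- away from 0; then x * y ≈ 0 forces y ≈ 0.
  *-≉0 : ∀ {x y} → x ≉ 0ℝ → y ≉ 0ℝ → x * y ≉ 0ℝ
  *-≉0 {x} {y} x≉0 y≉0 xy≈0 = x≉0 x≈0
    where
    open ℚ.≤-Reasoning

    xy-null : IsNull (λ n → seq x n ℚ.* seq y n)
    xy-null = null-resp (λ n → ℚ.+-identityʳ (seq x n ℚ.* seq y n)) xy≈0

    y-null : ∀ q N → 0ℚ ℚ.< q → (∀ n → N ℕ.≤ n → q ℚ.< ∣ seq x n ∣) → IsNull (seq y)
    y-null q N 0<q q<x ε 0<ε with xy-null (q ℚ.* ε) 0<qε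
      where
      0<qε : 0ℚ ℚ.< q ℚ.* ε
      0<qε = ℚ.positive⁻¹ (q ℚ.* ε)
        {{ℚ.pos*pos⇒pos q {{ℚ.positive 0<q}} ε {{ℚ.positive 0<ε}}}}
    ... | M , small = M ⊔ N , λ n M⊔N≤n → ℚ.≰⇒> λ ε≤y → ℚ.<-irrefl ≡.refl (begin-strict
        ∣ seq x n ℚ.* seq y n ∣
          <⟨ small n (ℕ.m⊔n≤o⇒m≤o M N M⊔N≤n) ⟩
        q ℚ.* ε
          ≤⟨ ℚ.*-monoˡ-≤-nonNeg q {{ℚ.nonNegative (ℚ.<⇒≤ 0<q)}} ε≤y ⟩
        q ℚ.* ∣ seq y n ∣
          ≤⟨ ℚ.*-monoʳ-≤-nonNeg ∣ seq y n ∣ {{ℚ.∣-∣-nonNeg (seq y n)}}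
               (ℚ.<⇒≤ (q<x n (ℕ.m⊔n≤o⇒n≤o M N M⊔N≤n))) ⟩
        ∣ seq x n ∣ ℚ.* ∣ seq y n ∣
          ≡⟨ ℚ.∣p*q∣≡∣p∣*∣q∣ (seq x n) (seq y n) ⟨
        ∣ seq x n ℚ.* seq y n ∣
          ∎)

    x-null : IsNull (seq x)
    x-null ε 0<ε with cauchy x (ε ℚ.* ½ ℚ.* ½) (0<ε*½ (0<ε*½ 0<ε))
    ... | N , close with ∣ seq x N ∣ ℚ.<? ε ℚ.* ½
    ...   | yes x<ε/2 = N , λ n N≤n → begin-strict
      ∣ seq x n ∣                                ≤⟨ ∣p∣≤∣q∣+∣p-q∣ (seq x n) (seq x N) ⟩
      ∣ seq x N ∣ ℚ.+ ∣ seq x n ℚ.- seq x N ∣    <⟨ ℚ.+-mono-< x<ε/2 (close n N N≤n ℕ.≤-refl) ⟩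
      ε ℚ.* ½ ℚ.+ ε ℚ.* ½ ℚ.* ½                  <⟨ ℚ.+-monoʳ-< (ε ℚ.* ½) (half< (0<ε*½ 0<ε)) ⟩
      ε ℚ.* ½ ℚ.+ ε ℚ.* ½                        ≡⟨ ε*½+ε*½≡ε ε ⟩
      ε                                          ∎
      where
      half< : ∀ {δ} → 0ℚ ℚ.< δ → δ ℚ.* ½ ℚ.< δ
      half< {δ} 0<δ = begin-strict
        δ ℚ.* ½                ≡⟨ ℚ.+-identityʳ (δ ℚ.* ½) ⟨
        δ ℚ.* ½ ℚ.+ 0ℚ         <⟨ ℚ.+-monoʳ-< (δ ℚ.* ½) (0<ε*½ 0<δ) ⟩
        δ ℚ.* ½ ℚ.+ δ ℚ.* ½    ≡⟨ ε*½+ε*½≡ε δ ⟩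
        δ                      ∎
    ...   | no x≮ε/2 = contradiction y≈0 y≉0
      where
      q : ℚ
      q = ε ℚ.* ½ ℚ.* ½

      q<x : ∀ n → N ℕ.≤ n → q ℚ.< ∣ seq x n ∣
      q<x n N≤n = ℚ.≰⇒> λ x≤q → x≮ε/2 (begin-strict
        ∣ seq x N ∣                                ≤⟨ ∣p∣≤∣q∣+∣p-q∣ (seq x N) (seq x n) ⟩
        ∣ seq x n ∣ ℚ.+ ∣ seq x N ℚ.- seq x n ∣    <⟨ ℚ.+-mono-≤-< x≤q (close N n ℕ.≤-refl N≤n) ⟩
        q ℚ.+ q                                    ≡⟨ ε*½+ε*½≡ε (ε ℚ.* ½) ⟩
        ε ℚ.* ½                                    ∎)

      y≈0 : y ≈ 0ℝ
      y≈0 = null-resp (λ n → ≡.sym (ℚ.+-identityʳ (seq y n)))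
              (y-null q N (0<ε*½ (0<ε*½ 0<ε)) q<x)

    x≈0 : x ≈ 0ℝ
    x≈0 = null-resp (λ n → ≡.sym (ℚ.+-identityʳ (seq x n))) x-null

≈0-*ˡ : ∀ {x} y → x ≈ 0ℝ → x * y ≈ 0ℝ
≈0-*ˡ y x≈0 = trans (*-cong x≈0 refl) (zeroˡ y)

≈0-*ʳ : ∀ x {y} → y ≈ 0ℝ → x * y ≈ 0ℝ
≈0-*ʳ x y≈0 = trans (*-cong refl y≈0) (zeroʳ x)

≈0-+ : ∀ {x y} → x ≈ 0ℝ → y ≈ 0ℝ → x + y ≈ 0ℝ
≈0-+ x≈0 y≈0 = trans (+-cong x≈0 y≈0) (+-identityʳ 0ℝ)

-- Serves to compute modulo relations: the solver proves `x ≈ y + z`, where `z` is an explicit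
-- combination of expressions known to vanish.
absorb : ∀ {x y z} → x ≈ y + z → z ≈ 0ℝ → x ≈ y
absorb x≈y+z z≈0 = trans x≈y+z (trans (+-cong refl z≈0) (+-identityʳ _))

≉0-resp : ∀ {x y} → x ≈ y → x ≉ 0ℝ → y ≉ 0ℝ
≉0-resp x≈y x≉0 y≈0 = x≉0 (trans x≈y y≈0)

*-≉0ˡ : ∀ {x y} → x * y ≉ 0ℝ → x ≉ 0ℝ
*-≉0ˡ {y = y} xy≉0 x≈0 = xy≉0 (≈0-*ˡ y x≈0)

*-≉0ʳ : ∀ {x y} → x * y ≉ 0ℝ → y ≉ 0ℝ
*-≉0ʳ {x = x} xy≉0 y≈0 = xy≉0 (≈0-*ʳ x y≈0)

-- Vectors in ℝ³

infix 9 _∙_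

_∙_ : Vector ℝ 3 → Vector ℝ 3 → ℝ
u ∙ v = u 0F * v 0F + (u 1F * v 1F + u 2F * v 2F)

⟨,⟩≈∙ : ∀ (u v : Vector ℝ 3) → ⟨ u , v ⟩ ≈ u ∙ v
⟨,⟩≈∙ u v = +-cong refl (+-cong refl (+-identityʳ _))

cross : Vector ℝ 3 → Vector ℝ 3 → Vector ℝ 3
cross u v =
  (u 1F * v 2F - u 2F * v 1F) ∷ (u 2F * v 0F - u 0F * v 2F) ∷
  (u 0F * v 1F - u 1F * v 0F) ∷ []

det : Vector ℝ 3 → Vector ℝ 3 → Vector ℝ 3 → ℝ
det u v w = cross u v ∙ w

-- |u|² times the component of v orthogonal to u.
rejection : Vector ℝ 3 → Vector ℝ 3 → Vector ℝ 3
rejection u v k = (u ∙ u) * v k - (u ∙ v) * u k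

-- Syntactic copies of the vector operations, so that identities checked in coordinates can still be
-- written in terms of vectors.
module _ {n : ℕ} where

  infix 9 _:∙_

  _:∙_ : Vector (Polynomial n) 3 → Vector (Polynomial n) 3 → Polynomial n
  u :∙ v = u 0F :* v 0F :+ (u 1F :* v 1F :+ u 2F :* v 2F)

  :cross : Vector (Polynomial n) 3 → Vector (Polynomial n) 3 → Vector (Polynomial n) 3
  :cross u v =
    (u 1F :* v 2F :- u 2F :* v 1F) ∷ (u 2F :* v 0F :- u 0F :* v 2F) ∷ (u 0F :* v 1F :- u 1F :* v 0F) ∷ []

  :rejection : Vector (Polynomial n) 3 → Vector (Polynomial n) 3 → Vector (Polynomial n) 3
  :rejection u v k = (u :∙ u) :* v k :- (u :∙ v) :* u k

∙-comm : ∀ u v → u ∙ v ≈ v ∙ u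
∙-comm u v = solve 6 (λ u₀ u₁ u₂ v₀ v₁ v₂ →
  let u = u₀ ∷ u₁ ∷ u₂ ∷ [] ; v = v₀ ∷ v₁ ∷ v₂ ∷ []
  in u :∙ v := v :∙ u) refl (u 0F) (u 1F) (u 2F) (v 0F) (v 1F) (v 2F)

lagrange : ∀ u v → cross u v ∙ cross u v ≈ (u ∙ u) * (v ∙ v) - (u ∙ v) * (u ∙ v)
lagrange u v = solve 6 (λ u₀ u₁ u₂ v₀ v₁ v₂ →
  let u = u₀ ∷ u₁ ∷ u₂ ∷ [] ; v = v₀ ∷ v₁ ∷ v₂ ∷ []
  in :cross u v :∙ :cross u v := u :∙ u :* v :∙ v :- u :∙ v :* u :∙ v)
  refl (u 0F) (u 1F) (u 2F) (v 0F) (v 1F) (v 2F)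

-- The Gram determinant of u, v, w against u, v, x.
bordered : (uu uv vv uw vw ux vx wx : ℝ) → ℝ
bordered uu uv vv uw vw ux vx wx =
  wx * (uu * vv - uv * uv) - uw * (ux * vv - uv * vx) + vw * (ux * uv - uu * vx)

-- Multiplicativity of the determinant: the matrix with rows `u`, `v`, `w` times the transpose of
-- the one with rows `u`, `v`, `x` has the inner products as entries.
det*det : ∀ u v w x → det u v w * det u v x ≈
  bordered (u ∙ u) (u ∙ v) (v ∙ v) (u ∙ w) (v ∙ w) (u ∙ x) (v ∙ x) (w ∙ x)
det*det u v w x = solve 12 (λ u₀ u₁ u₂ v₀ v₁ v₂ w₀ w₁ w₂ x₀ x₁ x₂ →
  let u = u₀ ∷ u₁ ∷ u₂ ∷ [] ; v = v₀ ∷ v₁ ∷ v₂ ∷ []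
      w = w₀ ∷ w₁ ∷ w₂ ∷ [] ; x = x₀ ∷ x₁ ∷ x₂ ∷ []
  in (:cross u v :∙ w) :* (:cross u v :∙ x) :=
     w :∙ x :* (u :∙ u :* v :∙ v :- u :∙ v :* u :∙ v)
       :- u :∙ w :* (u :∙ x :* v :∙ v :- u :∙ v :* v :∙ x)
       :+ v :∙ w :* (u :∙ x :* u :∙ v :- u :∙ u :* v :∙ x))
  refl (u 0F) (u 1F) (u 2F) (v 0F) (v 1F) (v 2F) (w 0F) (w 1F) (w 2F) (x 0F) (x 1F) (x 2F)

nonNeg-∙ : ∀ u → NonNeg (u ∙ u)
nonNeg-∙ u = nonNeg-+ (u 0F * u 0F) (u 1F * u 1F + u 2F * u 2F) (nonNeg-square (u 0F))
  (nonNeg-+ (u 1F * u 1F) (u 2F * u 2F) (nonNeg-square (u 1F)) (nonNeg-square (u 2F)))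

∙≉0 : ∀ u → ¬ (u ≈ᵥ 0ᵥ) → u ∙ u ≉ 0ℝ
-- A vanishing square gives a vanishing coordinate only up to double negation, which is enough
-- because the goal is empty.
∙≉0 u u≉0 uu≈0 = square≉0 (part 0F) λ u₀≈0 → square≉0 (part 1F) λ u₁≈0 → square≉0 (part 2F) λ u₂≈0 →
  u≉0 λ { 0F → u₀≈0 ; 1F → u₁≈0 ; 2F → u₂≈0 }
  where
  sq : _ → ℝ
  sq k = u k * u k

  square≉0 : ∀ {x} → x * x ≈ 0ℝ → ¬ (x ≉ 0ℝ)
  square≉0 xx≈0 x≉0 = *-≉0 x≉0 x≉0 xx≈0

  rearrange : ∀ x y z → x + (y + z) ≈ y + (z + x)
  rearrange = solve 3 (λ x y z → x :+ (y :+ z) := y :+ (z :+ x)) refl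

  first : ∀ i j k → sq i + (sq j + sq k) ≈ 0ℝ → sq i ≈ 0ℝ
  first i j k = nonNeg-+-≈0 (sq i) (sq j + sq k) (nonNeg-square (u i))
    (nonNeg-+ (sq j) (sq k) (nonNeg-square (u j)) (nonNeg-square (u k)))

  part : ∀ k → sq k ≈ 0ℝ
  part 0F = first 0F 1F 2F uu≈0
  part 1F = first 1F 2F 0F (trans (sym (rearrange (sq 0F) (sq 1F) (sq 2F))) uu≈0)
  part 2F = first 2F 0F 1F (trans (rearrange (sq 2F) (sq 0F) (sq 1F)) uu≈0)

-- The vectors orthogonal to y and z form a line, so u and w in transfer
-- are parallel.
module _ (y z : Vector ℝ 3) (y⊥z : y ∙ z ≈ 0ℝ) (yy≉0 : y ∙ y ≉ 0ℝ) (zz≉0 : z ∙ z ≉ 0ℝ) where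

  -- The orthogonality relations make the Gram matrix of `y`, `z`, `u` against `y`, `z`, `x`
  -- triangular.
  det*det-⊥ : ∀ u x → y ∙ u ≈ 0ℝ → z ∙ u ≈ 0ℝ →
              det y z u * det y z x ≈ (u ∙ x) * ((y ∙ y) * (z ∙ z))
  det*det-⊥ u x y⊥u z⊥u = absorb
    (trans (det*det y z u x)
      (solve 8 (λ yy yz zz yu zu yx zx ux →
        ux :* (yy :* zz :- yz :* yz) :- yu :* (yx :* zz :- yz :* zx) :+ zu :* (yx :* yz :- yy :* zx)
        := ux :* (yy :* zz) :+
           (yz :* (:- (ux :* yz)) :+ (yu :* (yz :* zx :- yx :* zz) :+ zu :* (yx :* yz :- yy :* zx))))
        refl (y ∙ y) (y ∙ z) (z ∙ z) (y ∙ u) (z ∙ u) (y ∙ x) (z ∙ x) (u ∙ x)))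
    (≈0-+ (≈0-*ˡ _ y⊥z) (≈0-+ (≈0-*ˡ _ y⊥u) (≈0-*ˡ _ z⊥u)))

  transfer : ∀ u w x → y ∙ u ≈ 0ℝ → z ∙ u ≈ 0ℝ → y ∙ w ≈ 0ℝ → z ∙ w ≈ 0ℝ →
             u ∙ u ≉ 0ℝ → w ∙ x ≉ 0ℝ → u ∙ x ≉ 0ℝ
  transfer u w x y⊥u z⊥u y⊥w z⊥w uu≉0 wx≉0 =
    *-≉0ˡ (≉0-resp (det*det-⊥ u x y⊥u z⊥u) (*-≉0 detu≉0 detx≉0))
    where
    -- Only the nonvanishing of products is used, so the scale factor between `u` and `w` is never
    -- formed.
    detu≉0 : det y z u ≉ 0ℝ
    detu≉0 = *-≉0ˡ (≉0-resp (sym (det*det-⊥ u u y⊥u z⊥u)) (*-≉0 uu≉0 (*-≉0 yy≉0 zz≉0)))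

    detx≉0 : det y z x ≉ 0ℝ
    detx≉0 = *-≉0ʳ (≉0-resp (sym (det*det-⊥ w x y⊥w z⊥w)) (*-≉0 wx≉0 (*-≉0 yy≉0 zz≉0)))

-- As `w` is orthogonal to `v` but not to `u`, the two cannot be parallel. Modulo `v ∙ w`, the
-- squares of `(u ∙ w)|v|` and `det u v w` add up to |u × v|²|w|², so the first would vanish
-- together with the cross product.
cross≉0 : ∀ u v w → v ∙ v ≉ 0ℝ → v ∙ w ≈ 0ℝ → u ∙ w ≉ 0ℝ → cross u v ∙ cross u v ≉ 0ℝ
cross≉0 u v w vv≉0 v⊥w uw≉0 uv≈0 = *-≉0 (*-≉0 uw≉0 uw≉0) vv≉0
  (nonNeg-+-≈0 ((u ∙ w) * (u ∙ w) * (v ∙ v)) (det u v w * det u v w)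
    (nonNeg-* ((u ∙ w) * (u ∙ w)) (v ∙ v) (nonNeg-square (u ∙ w)) (nonNeg-∙ v))
    (nonNeg-square (det u v w))
    (trans (+-cong refl (det*det u v w w))
      (trans
        (solve 6 (λ uu uv vv uw vw ww →
          uw :* uw :* vv :+
            (ww :* (uu :* vv :- uv :* uv) :- uw :* (uw :* vv :- uv :* vw) :+ vw :* (uw :* uv :- uu :* vw))
          := (uu :* vv :- uv :* uv) :* ww :+ vw :* (uv :* uw :+ (uw :* uv :- uu :* vw)))
          refl (u ∙ u) (u ∙ v) (v ∙ v) (u ∙ w) (v ∙ w) (w ∙ w))
        (≈0-+ (≈0-*ˡ _ (trans (sym (lagrange u v)) uv≈0)) (≈0-*ˡ _ v⊥w)))))

rejection-⊥ : ∀ u v → u ∙ rejection u v ≈ 0ℝ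
rejection-⊥ u v = trans (solve 6 (λ u₀ u₁ u₂ v₀ v₁ v₂ →
  let u = u₀ ∷ u₁ ∷ u₂ ∷ [] ; v = v₀ ∷ v₁ ∷ v₂ ∷ []
  -- The difference `u₀ :- u₀` stands for the zero polynomial.
  in u :∙ :rejection u v := u₀ :- u₀) refl (u 0F) (u 1F) (u 2F) (v 0F) (v 1F) (v 2F))
  (-‿inverseʳ (u 0F))

∙-rejection : ∀ u v w → w ∙ u ≈ 0ℝ → w ∙ v ≈ 0ℝ → w ∙ rejection u v ≈ 0ℝ
∙-rejection u v w w⊥u w⊥v = trans
  (solve 9 (λ u₀ u₁ u₂ v₀ v₁ v₂ w₀ w₁ w₂ →
    let u = u₀ ∷ u₁ ∷ u₂ ∷ [] ; v = v₀ ∷ v₁ ∷ v₂ ∷ [] ; w = w₀ ∷ w₁ ∷ w₂ ∷ []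
    in w :∙ :rejection u v := w :∙ v :* u :∙ u :+ w :∙ u :* (:- (u :∙ v)))
    refl (u 0F) (u 1F) (u 2F) (v 0F) (v 1F) (v 2F) (w 0F) (w 1F) (w 2F))
  (≈0-+ (≈0-*ˡ _ w⊥v) (≈0-*ˡ _ w⊥u))

-- The Gram determinant of four vectors in ℝ³.

-- The Gram matrix with diagonal α, β, γ, δ and off-diagonal entries
-- a = AB, b = BC, c = CD, d = AD, e = AC, f = BD.
gramDet : (α β γ δ a b c d e f : ℝ) → ℝ
gramDet α β γ δ a b c d e f =
  α * γ * (β * δ)
    - (γ * δ * (a * a) + α * β * (c * c) + (α * δ * (b * b) + β * γ * (d * d)))
    - (β * δ * (e * e) + α * γ * (f * f))
    + ((e + e) * (β * (c * d) + δ * (a * b)) + (f + f) * (α * (b * c) + γ * (a * d)))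
    + (a * c * (a * c) + b * d * (b * d) + e * f * (e * f))
    - (a * c * (b * d) + a * c * (b * d) + (a * c + b * d + (a * c + b * d)) * (e * f))

-- Sylvester's identity: the Gram determinant times its leading 2×2 minor is a 2×2 determinant of
-- bordered minors. By `det*det` these are the products of `det A B C` and `det A B D` with each
-- other and themselves, a matrix of rank at most one.
¬gramDet≉0 : ∀ A B C D → A ∙ A * B ∙ B - A ∙ B * A ∙ B ≉ 0ℝ →
  ¬ (gramDet (A ∙ A) (B ∙ B) (C ∙ C) (D ∙ D) (A ∙ B) (B ∙ C) (C ∙ D) (A ∙ D) (A ∙ C) (B ∙ D) ≉ 0ℝ)
¬gramDet≉0 A B C D p≉0 g≉0 = *-≉0 g≉0 p≉0 (trans sylvester (trans
  (+-cong (*-cong (sym (det*det A B C C)) (sym (det*det A B D D)))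
          (-‿cong (*-cong (sym (det*det A B C D)) (sym (det*det A B C D)))))
  (trans (solve 2 (λ x y → x :* x :* (y :* y) :- x :* y :* (x :* y) := x :- x) refl
           (det A B C) (det A B D))
         (-‿inverseʳ (det A B C)))))
  where
  sylvester = solve 10 (λ α β γ δ a b c d e f →
    let K = λ ux vx uy vy xy →
              xy :* (α :* β :- a :* a) :- ux :* (uy :* β :- a :* vy) :+ vx :* (uy :* a :- α :* vy)
    in (α :* γ :* (β :* δ)
         :- (γ :* δ :* (a :* a) :+ α :* β :* (c :* c) :+ (α :* δ :* (b :* b) :+ β :* γ :* (d :* d)))
         :- (β :* δ :* (e :* e) :+ α :* γ :* (f :* f))
         :+ ((e :+ e) :* (β :* (c :* d) :+ δ :* (a :* b)) :+ (f :+ f) :* (α :* (b :* c) :+ γ :* (a :* d)))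
         :+ (a :* c :* (a :* c) :+ b :* d :* (b :* d) :+ e :* f :* (e :* f))
         :- (a :* c :* (b :* d) :+ a :* c :* (b :* d) :+ (a :* c :+ b :* d :+ (a :* c :+ b :* d)) :* (e :* f)))
       :* (α :* β :- a :* a)
       := K e b e b γ :* K d f d f δ :- K e b d f c :* K e b d f c)
    refl (A ∙ A) (B ∙ B) (C ∙ C) (D ∙ D) (A ∙ B) (B ∙ C) (C ∙ D) (A ∙ D) (A ∙ C) (B ∙ D)

rejection-∙-AB-CD : ∀ A B C D → rejection A B ∙ rejection C D ≈
  A ∙ A * C ∙ C * B ∙ D + A ∙ B * C ∙ D * A ∙ C
    - (A ∙ A * (B ∙ C * C ∙ D) + C ∙ C * (A ∙ B * A ∙ D))
rejection-∙-AB-CD A B C D = solve 12 (λ a₀ a₁ a₂ b₀ b₁ b₂ c₀ c₁ c₂ d₀ d₁ d₂ →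
  let A = a₀ ∷ a₁ ∷ a₂ ∷ [] ; B = b₀ ∷ b₁ ∷ b₂ ∷ []
      C = c₀ ∷ c₁ ∷ c₂ ∷ [] ; D = d₀ ∷ d₁ ∷ d₂ ∷ []
  in :rejection A B :∙ :rejection C D :=
     A :∙ A :* C :∙ C :* B :∙ D :+ A :∙ B :* C :∙ D :* A :∙ C
       :- (A :∙ A :* (B :∙ C :* C :∙ D) :+ C :∙ C :* (A :∙ B :* A :∙ D)))
  refl (A 0F) (A 1F) (A 2F) (B 0F) (B 1F) (B 2F) (C 0F) (C 1F) (C 2F) (D 0F) (D 1F) (D 2F)

rejection-∙-BA-DC : ∀ A B C D → rejection B A ∙ rejection D C ≈
  B ∙ B * D ∙ D * A ∙ C + A ∙ B * C ∙ D * B ∙ D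
    - (B ∙ B * (C ∙ D * A ∙ D) + D ∙ D * (A ∙ B * B ∙ C))
rejection-∙-BA-DC A B C D = solve 12 (λ a₀ a₁ a₂ b₀ b₁ b₂ c₀ c₁ c₂ d₀ d₁ d₂ →
  let A = a₀ ∷ a₁ ∷ a₂ ∷ [] ; B = b₀ ∷ b₁ ∷ b₂ ∷ []
      C = c₀ ∷ c₁ ∷ c₂ ∷ [] ; D = d₀ ∷ d₁ ∷ d₂ ∷ []
  in :rejection B A :∙ :rejection D C :=
     B :∙ B :* D :∙ D :* A :∙ C :+ A :∙ B :* C :∙ D :* B :∙ D
       :- (B :∙ B :* (C :∙ D :* A :∙ D) :+ D :∙ D :* (A :∙ B :* B :∙ C)))
  refl (A 0F) (A 1F) (A 2F) (B 0F) (B 1F) (B 2F) (C 0F) (C 1F) (C 2F) (D 0F) (D 1F) (D 2F)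

-- Expanded, the two inner products of rejections differ only in their `A ∙ C` terms. This is where
-- D₀ and D₁ combine.
rejection-∙-difference : ∀ A B C D → A ∙ C * (B ∙ C * A ∙ D - A ∙ B * C ∙ D) ≈
  rejection A D ∙ rejection C B - rejection A B ∙ rejection C D
rejection-∙-difference A B C D = solve 12 (λ a₀ a₁ a₂ b₀ b₁ b₂ c₀ c₁ c₂ d₀ d₁ d₂ →
  let A = a₀ ∷ a₁ ∷ a₂ ∷ [] ; B = b₀ ∷ b₁ ∷ b₂ ∷ []
      C = c₀ ∷ c₁ ∷ c₂ ∷ [] ; D = d₀ ∷ d₁ ∷ d₂ ∷ []
  in A :∙ C :* (B :∙ C :* A :∙ D :- A :∙ B :* C :∙ D) :=
     :rejection A D :∙ :rejection C B :- :rejection A B :∙ :rejection C D)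
  refl (A 0F) (A 1F) (A 2F) (B 0F) (B 1F) (B 2F) (C 0F) (C 1F) (C 2F) (D 0F) (D 1F) (D 2F)

-- Positivity of the Gram determinant under the edge relations.

-- The Gram matrix of gramDet again, with p, q, r, s in place of |A × B|²,
-- |B × C|², |C × D|², |A × D|².  f-eq and e-eq express the edges D₁ and D₂,
-- while D₀ and D₁ together give ac = bd.
module Quadrilateral
  (α β γ δ a b c d e f p q r s : ℝ)
  (0≤γ : NonNeg γ) (0≤δ : NonNeg δ)
  (0≤p : NonNeg p) (0≤q : NonNeg q) (0≤r : NonNeg r) (0≤s : NonNeg s)
  (p≈ : p ≈ α * β - a * a) (q≈ : q ≈ β * γ - b * b)
  (r≈ : r ≈ γ * δ - c * c) (s≈ : s ≈ α * δ - d * d)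
  (f-eq : α * γ * f + a * c * e - (α * (b * c) + γ * (a * d)) ≈ 0ℝ)
  (e-eq : β * δ * e + a * c * f - (β * (c * d) + δ * (a * b)) ≈ 0ℝ)
  (bd-ac≈0 : b * d - a * c ≈ 0ℝ)
  where

  open SetoidReasoning setoid

  -- `f-eq` and `e-eq` form a linear system in `e` and `f` with determinant `m` and right sides `Q`
  -- and `P`; `E` and `F` are its numerators in Cramer's rule. In `Y`, `t * t` replaces the square
  -- of `b * d`, with which it agrees by `bd-ac≈0`.
  t k l m n P Q R U W E F X Y : ℝ
  t = a * c
  k = α * γ
  l = β * δ
  n = k * l
  m = n - t * t
  P = β * (c * d) + δ * (a * b)
  Q = α * (b * c) + γ * (a * d)
  U = γ * δ * (a * a) + α * β * (c * c)
  W = α * δ * (b * b) + β * γ * (d * d)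
  E = k * P - t * Q
  F = l * Q - t * P
  R = k * (P * P) + l * (Q * Q)
  X = n + t * t - U
  Y = n + t * t - W

  me≈E : m * e ≈ E
  me≈E = absorb
    (solve 7 (λ k l t P Q e f →
      (k :* l :- t :* t) :* e :=
      k :* P :- t :* Q :+ ((l :* e :+ t :* f :- P) :* k :+ (k :* f :+ t :* e :- Q) :* (:- t)))
      refl k l t P Q e f)
    (≈0-+ (≈0-*ˡ _ e-eq) (≈0-*ˡ _ f-eq))

  mf≈F : m * f ≈ F
  mf≈F = absorb
    (solve 7 (λ k l t P Q e f →
      (k :* l :- t :* t) :* f :=
      l :* Q :- t :* P :+ ((k :* f :+ t :* e :- Q) :* l :+ (l :* e :+ t :* f :- P) :* (:- t)))
      refl k l t P Q e f)
    (≈0-+ (≈0-*ˡ _ f-eq) (≈0-*ˡ _ e-eq))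

  -- Together with `R≈`, this eliminates `P` and `Q`: once `b * d` is replaced by `t`, both
  -- symmetric combinations depend only on `n`, `t`, `U` and `W`.
  PQ≈ : P * Q ≈ t * (U + W)
  PQ≈ = absorb
    (solve 8 (λ α β γ δ a b c d →
      (β :* (c :* d) :+ δ :* (a :* b)) :* (α :* (b :* c) :+ γ :* (a :* d)) :=
      a :* c :* (γ :* δ :* (a :* a) :+ α :* β :* (c :* c) :+ (α :* δ :* (b :* b) :+ β :* γ :* (d :* d)))
        :+ (b :* d :- a :* c) :* (γ :* δ :* (a :* a) :+ α :* β :* (c :* c)))
      refl α β γ δ a b c d)
    (≈0-*ˡ _ bd-ac≈0)

  R≈ : R ≈ U * W + n * ((t + t) * (t + t))
  R≈ = absorb
    (solve 8 (λ α β γ δ a b c d →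
      let P = β :* (c :* d) :+ δ :* (a :* b)
          Q = α :* (b :* c) :+ γ :* (a :* d)
          t = a :* c
          n = α :* γ :* (β :* δ)
      in α :* γ :* (P :* P) :+ β :* δ :* (Q :* Q) :=
         (γ :* δ :* (a :* a) :+ α :* β :* (c :* c)) :* (α :* δ :* (b :* b) :+ β :* γ :* (d :* d))
           :+ n :* ((t :+ t) :* (t :+ t))
           :+ (b :* d :- a :* c) :* (n :* (t :+ t :+ (t :+ t))))
      refl α β γ δ a b c d)
    (≈0-*ˡ _ bd-ac≈0)

  g : ℝ
  g = n - (U + W) + (l * (e * e) + k * (f * f)) + e * f * (e * f)

  -- Substituting for `P` and `Q` from the edge relations turns the terms linear in them into 2(le²
  -- + kf²) + 4tef. This flips the sign of le² + kf² and cancels the mixed term.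
  gramDet≈ : gramDet α β γ δ a b c d e f ≈ g
  gramDet≈ = absorb
    (solve 10 (λ α β γ δ a b c d e f →
      let P = β :* (c :* d) :+ δ :* (a :* b)
          Q = α :* (b :* c) :+ γ :* (a :* d)
          t = a :* c
          t′ = b :* d
          k = α :* γ
          l = β :* δ
          U = γ :* δ :* (a :* a) :+ α :* β :* (c :* c)
          W = α :* δ :* (b :* b) :+ β :* γ :* (d :* d)
      in k :* l :- (U :+ W) :- (l :* (e :* e) :+ k :* (f :* f))
           :+ ((e :+ e) :* P :+ (f :+ f) :* Q)
           :+ (t :* t :+ t′ :* t′ :+ e :* f :* (e :* f))
           :- (t :* t′ :+ t :* t′ :+ (t :+ t′ :+ (t :+ t′)) :* (e :* f))
         := k :* l :- (U :+ W) :+ (l :* (e :* e) :+ k :* (f :* f)) :+ e :* f :* (e :* f)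
            :+ ((l :* e :+ t :* f :- P) :* (:- (e :+ e))
                :+ ((k :* f :+ t :* e :- Q) :* (:- (f :+ f))
                    :+ (t′ :- t) :* (t′ :- t :- (e :* f :+ e :* f)))))
      refl α β γ δ a b c d e f)
    (≈0-+ (≈0-*ˡ _ e-eq) (≈0-+ (≈0-*ˡ _ f-eq) (≈0-*ˡ _ bd-ac≈0)))

  -- m⁴ g as a function of l(me)² + k(mf)² and (me)(mf), the two
  -- expressions in which me and mf are then replaced by E and F.
  Φ : ℝ → ℝ → ℝ
  Φ x y = m * m * (m * m) * (n - (U + W)) + m * m * x + y * y

  Φ-cong : ∀ {x x′ y y′} → x ≈ x′ → y ≈ y′ → Φ x y ≈ Φ x′ y′
  Φ-cong x≈x′ y≈y′ = +-cong (+-cong refl (*-cong refl x≈x′)) (*-cong y≈y′ y≈y′)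

  m⁴g≈ : m * m * (m * m) * g ≈ m * m * m * (X * Y) + t * (X * Y) * (t * (X * Y))
  m⁴g≈ = begin
    m * m * (m * m) * g
      ≈⟨ solve 7 (λ m N k l e f V →
           m :* m :* (m :* m) :* (N :- V :+ (l :* (e :* e) :+ k :* (f :* f)) :+ e :* f :* (e :* f)) :=
           m :* m :* (m :* m) :* (N :- V)
             :+ m :* m :* (l :* (m :* e :* (m :* e)) :+ k :* (m :* f :* (m :* f)))
             :+ m :* e :* (m :* f) :* (m :* e :* (m :* f)))
           refl m n k l e f (U + W) ⟩
    Φ (l * (m * e * (m * e)) + k * (m * f * (m * f))) (m * e * (m * f))
      ≈⟨ Φ-cong (+-cong (*-cong refl (*-cong me≈E me≈E)) (*-cong refl (*-cong mf≈F mf≈F)))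
                (*-cong me≈E mf≈F) ⟩
    Φ (l * (E * E) + k * (F * F)) (E * F)
      ≈⟨ Φ-cong
           (solve 5 (λ k l t P Q →
             l :* ((k :* P :- t :* Q) :* (k :* P :- t :* Q))
               :+ k :* ((l :* Q :- t :* P) :* (l :* Q :- t :* P)) :=
             (k :* l :+ t :* t) :* (k :* (P :* P) :+ l :* (Q :* Q))
               :- (t :+ t) :* (k :* l :+ k :* l) :* (P :* Q))
             refl k l t P Q)
           (solve 5 (λ k l t P Q →
             (k :* P :- t :* Q) :* (l :* Q :- t :* P) :=
             (k :* l :+ t :* t) :* (P :* Q) :- t :* (k :* (P :* P) :+ l :* (Q :* Q)))
             refl k l t P Q) ⟩
    Φ ((n + t * t) * R - (t + t) * (n + n) * (P * Q)) ((n + t * t) * (P * Q) - t * R)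
      ≈⟨ Φ-cong (+-cong (*-cong refl R≈) (-‿cong (*-cong refl PQ≈)))
                (+-cong (*-cong refl PQ≈) (-‿cong (*-cong refl R≈))) ⟩
    Φ ((n + t * t) * (U * W + n * ((t + t) * (t + t))) - (t + t) * (n + n) * (t * (U + W)))
      ((n + t * t) * (t * (U + W)) - t * (U * W + n * ((t + t) * (t + t))))
      -- As (n + t²)² - 4nt² = m², here y = t(m² - XY), and x + m²(n + t² - U - W) = (n + t²)XY.
      -- Substituting both leaves m³XY + t²(XY)².
      ≈⟨ solve 4 (λ n t U W →
           let m = n :- t :* t
               X = n :+ t :* t :- U
               Y = n :+ t :* t :- W
               D = U :* W :+ n :* ((t :+ t) :* (t :+ t))
               x = (n :+ t :* t) :* D :- (t :+ t) :* (n :+ n) :* (t :* (U :+ W))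
               y = (n :+ t :* t) :* (t :* (U :+ W)) :- t :* D
           in m :* m :* (m :* m) :* (n :- (U :+ W)) :+ m :* m :* x :+ y :* y :=
              m :* m :* m :* (X :* Y) :+ t :* (X :* Y) :* (t :* (X :* Y)))
           refl n t U W ⟩
    m * m * m * (X * Y) + t * (X * Y) * (t * (X * Y))
      ∎

  -- The factors m and XY of the right-hand side of m⁴g≈, written without
  -- subtraction so that NonNeg applies to them.
  M Z : ℝ
  M = p * (γ * δ) + a * a * r
  Z = p * r * (q * s)

  m≈M : m ≈ M
  m≈M = trans
    (solve 6 (λ α β γ δ a c →
      α :* γ :* (β :* δ) :- a :* c :* (a :* c) :=
      (α :* β :- a :* a) :* (γ :* δ) :+ a :* a :* (γ :* δ :- c :* c))
      refl α β γ δ a c)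
    (+-cong (*-cong (sym p≈) refl) (*-cong refl (sym r≈)))

  X≈ : X ≈ p * r
  X≈ = trans
    (solve 6 (λ α β γ δ a c →
      α :* γ :* (β :* δ) :+ a :* c :* (a :* c) :- (γ :* δ :* (a :* a) :+ α :* β :* (c :* c)) :=
      (α :* β :- a :* a) :* (γ :* δ :- c :* c))
      refl α β γ δ a c)
    (*-cong (sym p≈) (sym r≈))

  Y≈ : Y ≈ q * s
  Y≈ = trans
    (absorb
      (solve 7 (λ α β γ δ t b d →
        α :* γ :* (β :* δ) :+ t :* t :- (α :* δ :* (b :* b) :+ β :* γ :* (d :* d)) :=
        (β :* γ :- b :* b) :* (α :* δ :- d :* d) :+ (b :* d :- t) :* (:- (b :* d :+ t)))
        refl α β γ δ t b d)
      (≈0-*ˡ _ bd-ac≈0))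
    (*-cong (sym q≈) (sym s≈))

  -- If the determinant vanished, so would a sum of two nonnegative terms, hence also the summand
  -- `t * Z * (t * Z)`, all of whose factors are nonzero.
  gramDet-≉0 : p ≉ 0ℝ → q ≉ 0ℝ → r ≉ 0ℝ → s ≉ 0ℝ → a ≉ 0ℝ → c ≉ 0ℝ →
                     gramDet α β γ δ a b c d e f ≉ 0ℝ
  gramDet-≉0 p≉0 q≉0 r≉0 s≉0 a≉0 c≉0 gramDet≈0 = *-≉0 tZ≉0 tZ≉0
    (nonNeg-+-≈0 (t * Z * (t * Z)) (M * M * M * Z)
      (nonNeg-square (t * Z)) (nonNeg-* (M * M * M) Z 0≤M³ 0≤Z) (begin
        t * Z * (t * Z) + M * M * M * Z
          ≈⟨ +-comm _ _ ⟩
        M * M * M * Z + t * Z * (t * Z)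
          ≈⟨ +-cong (*-cong (*-cong (*-cong m≈M m≈M) m≈M) XY≈Z)
                    (*-cong (*-cong refl XY≈Z) (*-cong refl XY≈Z)) ⟨
        m * m * m * (X * Y) + t * (X * Y) * (t * (X * Y))
          ≈⟨ m⁴g≈ ⟨
        m * m * (m * m) * g
          ≈⟨ ≈0-*ʳ _ (trans (sym gramDet≈) gramDet≈0) ⟩
        0ℝ
          ∎))
    where
    XY≈Z : X * Y ≈ Z
    XY≈Z = *-cong X≈ Y≈

    tZ≉0 : t * Z ≉ 0ℝ
    tZ≉0 = *-≉0 (*-≉0 a≉0 c≉0) (*-≉0 (*-≉0 p≉0 r≉0) (*-≉0 q≉0 s≉0))

    0≤M : NonNeg M
    0≤M = nonNeg-+ (p * (γ * δ)) (a * a * r)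
      (nonNeg-* p (γ * δ) 0≤p (nonNeg-* γ δ 0≤γ 0≤δ)) (nonNeg-* (a * a) r (nonNeg-square a) 0≤r)

    0≤M³ : NonNeg (M * M * M)
    0≤M³ = nonNeg-* (M * M) M (nonNeg-square M) 0≤M

    0≤Z : NonNeg Z
    0≤Z = nonNeg-* (p * r) (q * s) (nonNeg-* p r 0≤p 0≤r) (nonNeg-* q s 0≤q 0≤s)

-- Instead of cancelling `A ∙ C` to obtain ac = bd, the proof shows that bd - ac is nonzero as well,
-- contradicting the vanishing of the product.
no-quadrilateral : ∀ A B C D →
  cross A B ∙ cross A B ≉ 0ℝ → cross B C ∙ cross B C ≉ 0ℝ →
  cross C D ∙ cross C D ≉ 0ℝ → cross A D ∙ cross A D ≉ 0ℝ →
  A ∙ B ≉ 0ℝ → C ∙ D ≉ 0ℝ → A ∙ C ≉ 0ℝ →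
  rejection A D ∙ rejection C B ≈ 0ℝ → rejection A B ∙ rejection C D ≈ 0ℝ →
  rejection B A ∙ rejection D C ≈ 0ℝ → ⊥
no-quadrilateral A B C D p≉0 q≉0 r≉0 s≉0 a≉0 c≉0 e≉0 AD⊥CB AB⊥CD BA⊥DC =
  *-≉0 e≉0 bd-ac≉0 (trans (rejection-∙-difference A B C D)
    (trans (+-cong AD⊥CB (-‿cong AB⊥CD)) (-‿inverseʳ 0ℝ)))
  where
  bd-ac≉0 : B ∙ C * A ∙ D - A ∙ B * C ∙ D ≉ 0ℝ
  bd-ac≉0 bd-ac≈0 = ¬gramDet≉0 A B C D (≉0-resp (lagrange A B) p≉0)
    (Quadrilateral.gramDet-≉0
      (A ∙ A) (B ∙ B) (C ∙ C) (D ∙ D) (A ∙ B) (B ∙ C) (C ∙ D) (A ∙ D) (A ∙ C) (B ∙ D)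
      -- Squared lengths of cross products are sums of squares, hence `NonNeg` termwise; `lagrange`
      -- identifies them with the 2×2 minors.
      (cross A B ∙ cross A B) (cross B C ∙ cross B C) (cross C D ∙ cross C D) (cross A D ∙ cross A D)
      (nonNeg-∙ C) (nonNeg-∙ D)
      (nonNeg-∙ (cross A B)) (nonNeg-∙ (cross B C)) (nonNeg-∙ (cross C D)) (nonNeg-∙ (cross A D))
      (lagrange A B) (lagrange B C) (lagrange C D) (lagrange A D)
      (trans (sym (rejection-∙-AB-CD A B C D)) AB⊥CD)
      (trans (sym (rejection-∙-BA-DC A B C D)) BA⊥DC)
      bd-ac≈0 p≉0 q≉0 r≉0 s≉0 a≉0 c≉0)

-- Midpoints as rejections.

-- y is orthogonal to both P and Q, hence v, being orthogonal to y and P,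
-- is parallel to rejection P Q.
record IsMidpoint (P Q y v : Vector ℝ 3) : Set where
  field
    P≉0 : ¬ (P ≈ᵥ 0ᵥ)
    y≉0 : ¬ (y ≈ᵥ 0ᵥ)
    v≉0 : ¬ (v ≈ᵥ 0ᵥ)
    y⊥P : y ∙ P ≈ 0ℝ
    y⊥Q : y ∙ Q ≈ 0ℝ
    P⊥v : P ∙ v ≈ 0ℝ
    y⊥v : y ∙ v ≈ 0ℝ

midpoint-≉0 : ∀ P Q y v x → IsMidpoint P Q y v → rejection P Q ∙ x ≉ 0ℝ → v ∙ x ≉ 0ℝ
midpoint-≉0 P Q y v x isMid =
  transfer y P y⊥P (∙≉0 y y≉0) (∙≉0 P P≉0) v (rejection P Q) x y⊥v P⊥v
    (∙-rejection P Q y y⊥P y⊥Q) (rejection-⊥ P Q) (∙≉0 v v≉0)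
  where open IsMidpoint isMid

-- Non-orthogonality passes from the rejections to the midpoints, one vector at a time. The double
-- negation arises because `transfer` speaks of nonvanishing only.
midpoints-⊥ : ∀ P Q y v P′ Q′ y′ v′ → IsMidpoint P Q y v → IsMidpoint P′ Q′ y′ v′ →
              v ∙ v′ ≈ 0ℝ → ¬ (rejection P Q ∙ rejection P′ Q′ ≉ 0ℝ)
midpoints-⊥ P Q y v P′ Q′ y′ v′ isMid isMid′ v⊥v′ ww′≉0 =
  midpoint-≉0 P′ Q′ y′ v′ v isMid′
    (≉0-resp (∙-comm v (rejection P′ Q′)) (midpoint-≉0 P Q y v (rejection P′ Q′) isMid ww′≉0))
    (trans (∙-comm v′ v) v⊥v′)

-- Adjacency of corners and midpoints.

open Hypergraph₃ H₂₀ using (_∈_)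

infix 4 _On_ _On?_

_On_ : Fin 8 → Fin 8 → Set
k On j = prev j ≡ k ⊎ j ≡ k

_On?_ : ∀ k j → Dec (k On j)
k On? j = (prev j ≟ k) ⊎-dec (j ≟ k)

corner∈⇒side : ∀ {k e} → corner k ∈ e → ∃[ j ] e ≡ side j × k On j
corner∈⇒side {e = side j} (0F , ≡.refl) = j , ≡.refl , inj₁ ≡.refl
corner∈⇒side {e = side j} (2F , ≡.refl) = j , ≡.refl , inj₂ ≡.refl
corner∈⇒side {e = side j} (1F , ())
corner∈⇒side {e = D₀} (0F , ())
corner∈⇒side {e = D₀} (1F , ())
corner∈⇒side {e = D₀} (2F , ())
corner∈⇒side {e = D₁} (0F , ())
corner∈⇒side {e = D₁} (1F , ())
corner∈⇒side {e = D₁} (2F , ())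
corner∈⇒side {e = D₂} (0F , ())
corner∈⇒side {e = D₂} (1F , ())
corner∈⇒side {e = D₂} (2F , ())
corner∈⇒side {e = D₃} (0F , ())
corner∈⇒side {e = D₃} (1F , ())
corner∈⇒side {e = D₃} (2F , ())

corner∈side⇒On : ∀ {k j} → corner k ∈ side j → k On j
corner∈side⇒On (0F , ≡.refl) = inj₁ ≡.refl
corner∈side⇒On (2F , ≡.refl) = inj₂ ≡.refl

mid∈side⇒≡ : ∀ {k j} → mid k ∈ side j → j ≡ k
mid∈side⇒≡ (1F , ≡.refl) = ≡.refl
mid∈side⇒≡ (0F , ())
mid∈side⇒≡ (2F , ())

Adjacent : Vertex → Vertex → Set
Adjacent u v = ∃[ e ] u ∈ e × v ∈ e

-- Corners lie on sides only, so a common hyperedge would be one of the eight sides.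
corners-nonadjacent : ∀ k l → ¬ (∃[ j ] k On j × l On j) → ¬ Adjacent (corner k) (corner l)
corners-nonadjacent k l no-side (e , k∈e , l∈e) with corner∈⇒side {k} {e} k∈e
... | j , ≡.refl , k-on-j = no-side (j , k-on-j , corner∈side⇒On {l} {j} l∈e)

corner-mid-nonadjacent : ∀ k j → ¬ (k On j) → ¬ Adjacent (corner k) (mid j)
corner-mid-nonadjacent k j k-off-j (e , k∈e , j∈e) with corner∈⇒side {k} {e} k∈e
... | i , ≡.refl , k-on-i = k-off-j (subst (k On_) (mid∈side⇒≡ {j} {i} j∈e) k-on-i)

-- The contradiction from a representation.

module _ (rep : FaithfulOrthogonalRepresentation H₂₀ 3) where

  open FaithfulOrthogonalRepresentation rep

  A B C D : Vector ℝ 3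
  A = x (corner 0F)
  B = x (corner 2F)
  C = x (corner 4F)
  D = x (corner 6F)

  ⊥-edge : ∀ e i j → i ≢ j → x (vertices₂₀ e i) ∙ x (vertices₂₀ e j) ≈ 0ℝ
  ⊥-edge e i j i≢j = trans (sym (⟨,⟩≈∙ (x (vertices₂₀ e i)) (x (vertices₂₀ e j))))
    (Equivalence.from (orthogonal (i≢j ∘ Hypergraph₃.distinct H₂₀ e))
      (e , (i , ≡.refl) , (j , ≡.refl)))

  ∙-≉0 : ∀ {u v} → u ≢ v → ¬ Adjacent u v → x u ∙ x v ≉ 0ℝ
  ∙-≉0 {u} {v} u≢v ¬adj uv≈0 =
    ¬adj (Equivalence.to (orthogonal u≢v) (trans (⟨,⟩≈∙ (x u) (x v)) uv≈0))

  -- For concrete indices the implicit argument evaluates to the unit type, so non-adjacency is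
  -- settled by computation.
  corners-≉0 : ∀ k l → {False (any? λ j → (k On? j) ×-dec (l On? j))} → k ≢ l →
               x (corner k) ∙ x (corner l) ≉ 0ℝ
  corners-≉0 k l {no-side} k≢l = ∙-≉0 (λ { ≡.refl → k≢l ≡.refl })
    (corners-nonadjacent k l (toWitnessFalse no-side))

  corner-mid-≉0 : ∀ k j → {False (k On? j)} → x (corner k) ∙ x (mid j) ≉ 0ℝ
  corner-mid-≉0 k j {k-off-j} = ∙-≉0 (λ ()) (corner-mid-nonadjacent k j (toWitnessFalse k-off-j))

  -- The midpoint `mid j`, on a side through `corner l` but not through `corner k`, is the vector
  -- separating the two rays.
  corners-cross-≉0 : ∀ k l j → {False (k On? j)} → x (corner l) ∙ x (mid j) ≈ 0ℝ →
             cross (x (corner k)) (x (corner l)) ∙ cross (x (corner k)) (x (corner l)) ≉ 0ℝ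
  corners-cross-≉0 k l j {k-off-j} l⊥j = cross≉0 (x (corner k)) (x (corner l)) (x (mid j))
    (∙≉0 (x (corner l)) (nonzero (corner l))) l⊥j (corner-mid-≉0 k j {k-off-j})

  -- The sides `prev j` and `j` share the corner taken as `y`. The midpoint of the first is treated
  -- here, that of the second in `isMidpoint-backward`.
  isMidpoint-forward : ∀ j →
    IsMidpoint (x (corner (prev (prev j)))) (x (corner j)) (x (corner (prev j))) (x (mid (prev j)))
  isMidpoint-forward j = record
    { P≉0 = nonzero _
    ; y≉0 = nonzero _
    ; v≉0 = nonzero _
    ; y⊥P = ⊥-edge (side (prev j)) 2F 0F λ ()
    ; y⊥Q = ⊥-edge (side j) 0F 2F λ ()
    ; P⊥v = ⊥-edge (side (prev j)) 0F 1F λ ()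
    ; y⊥v = ⊥-edge (side (prev j)) 2F 1F λ ()
    }

  isMidpoint-backward : ∀ j →
    IsMidpoint (x (corner j)) (x (corner (prev (prev j)))) (x (corner (prev j))) (x (mid j))
  isMidpoint-backward j = record
    { P≉0 = nonzero _
    ; y≉0 = nonzero _
    ; v≉0 = nonzero _
    ; y⊥P = ⊥-edge (side j) 0F 2F λ ()
    ; y⊥Q = ⊥-edge (side (prev j)) 2F 0F λ ()
    ; P⊥v = ⊥-edge (side j) 2F 1F λ ()
    ; y⊥v = ⊥-edge (side j) 0F 1F λ ()
    }

  unrepresentable : ⊥
  unrepresentable =
    -- Up to scale, v₀ and v₄ are the rejections of D from A and of B from C; v₁ and v₅ those of B
    -- from A and of D from C; v₂ and v₆ those of A from B and of C from D.
    midpoints-⊥ A D _ _ C B _ _ (isMidpoint-backward 0F) (isMidpoint-backward 4F)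
      (⊥-edge D₀ 0F 2F λ ()) λ AD⊥CB →
    midpoints-⊥ A B _ _ C D _ _ (isMidpoint-forward 2F) (isMidpoint-forward 6F)
      (⊥-edge D₁ 0F 2F λ ()) λ AB⊥CD →
    midpoints-⊥ B A _ _ D C _ _ (isMidpoint-backward 2F) (isMidpoint-backward 6F)
      (⊥-edge D₂ 0F 2F λ ()) λ BA⊥DC →
    no-quadrilateral A B C D
      (corners-cross-≉0 0F 2F 3F (⊥-edge (side 3F) 0F 1F λ ()))
      (corners-cross-≉0 2F 4F 5F (⊥-edge (side 5F) 0F 1F λ ()))
      (corners-cross-≉0 4F 6F 7F (⊥-edge (side 7F) 0F 1F λ ()))
      (corners-cross-≉0 0F 6F 6F (⊥-edge (side 6F) 2F 1F λ ()))
      (corners-≉0 0F 2F λ ()) (corners-≉0 4F 6F λ ()) (corners-≉0 0F 4F λ ())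
      AD⊥CB AB⊥CD BA⊥DC

theorem5 : ¬ FaithfulOrthogonalRepresentation H₂₀ 3
theorem5 = unrepresentable
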